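{- The following decision problem is undecidable: given a two-dimensional (deterministic) substitution $\sigma$ on a finite alphabet which is consistent, determine whether $\sigma$ is overlapping. (That is, there is no algorithm which, on every input that is a consistent two-dimensional substitution, correctly decides whether it is overlapping.)
   Context: **Cells and patterns.** Let $\mathcal{A}$ be a finite set of symbols (the alphabet). A $d$-dimensional cell is a pair $c=[v,t]$ with $v\in\mathbb{Z}^d$ (the vector of $c$) and $t\in\mathcal{A}$ (the type of $c$). A $d$-dimensional pattern is a finite set of $d$-dimensional cells with pairwise distinct vectors. Patterns are translated by elements of $\mathbb{Z}^d$ by translating the vectors of their cells. The support of $P$ is $\mathrm{supp}(P)=\{v:[v,t]\in P\}$. **Substitutions.** A $d$-dimensional substitution $\sigma$ on $\mathcal{A}$ consists of a base rule, i.e. a map $\sigma_{\mathrm{base}}$ from $\mathcal{A}$ to the set of $d$-dimensional patterns, and a finite set of concatenation rules $(t,t',u)\mapsto v$ with $t,t'\in\mathcal{A}$, $u,v\in\mathbb{Z}^d$, $u\neq 0$. All substitutions are assumed deterministic: if a rule has left-hand side $(t,t',u)$, then no other rule has left-hand side $(t,t',u)$ or $(t',t,-u)$. For a cell $c=[v,t]$ put $\sigma_{\mathrm{base}}(c)=\sigma_{\mathrm{base}}(t)$. The set of starting patterns of $\sigma$ is $\mathcal{C}_\sigma=\{\{[0,t],[u,t']\} : (t,t',u)\mapsto v \text{ is a rule of } \sigma \text{ for some } v\}$. For cells $c=[u,t]$, $c'=[u',t']$, set $\sigma_{\mathrm{rule}}(c,c')=v$ if $(t,t',u'-u)\mapsto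 v$ is a rule of $\sigma$, $\sigma_{\mathrm{rule}}(c,c')=-v$ if $(t',t,u-u')\mapsto v$ is a rule of $\sigma$, and leave it undefined otherwise. **Paths.** A $\mathcal{C}_\sigma$-path from $c_1$ to $c_n$ is a finite sequence of cells $\gamma=(c_1,\dots,c_n)$ such that $\{c_i,c_{i+1}\}$ is a translate of an element of $\mathcal{C}_\sigma$ for all $1\le i\le n-1$, and such that $c_i=c_j$ whenever $c_i$ and $c_j$ have the same vector. It is a $\mathcal{C}_\sigma$-path of a pattern $P$ if all its cells belong to $P$. A pattern $P$ is $\mathcal{C}_\sigma$-covered if for all $c,c'\in P$ there is a $\mathcal{C}_\sigma$-path of $P$ from $c$ to $c'$. The image vector of $\gamma$ is $\omega_\sigma(\gamma)=\sum_{i=1}^{n-1}\sigma_{\mathrm{rule}}(c_i,c_{i+1})$. **Consistency and overlapping.** Let $P$ be a $\mathcal{C}_\sigma$-covered pattern. $\sigma$ is consistent on $P$ if for all cells $c,c'\in P$ and all $\mathcal{C}_\sigma$-paths $\gamma,\gamma'$ of $P$ from $c$ to $c'$ we have $\omega_\sigma(\gamma)=\omega_\sigma(\gamma')$. $\sigma$ is non-overlapping on $P$ if for all cells $c\neq c'$ of $P$ and every $\mathcal{C}_\sigma$-path $\gamma$ of $P$ from $c$ to $c'$ we have $\mathrm{supp}(\sigma_{\mathrm{base}}(c))\cap \mathrm{supp}(\omega_\sigma(\gamma)+\sigma_{\mathrm{base}}(c'))=\varnothing$. $\sigma$ is consistent (resp. non-overlapping) if it is so on every $\mathcal{C}_\sigma$-covered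 pattern; $\sigma$ is overlapping if it is not non-overlapping. -}

module Defs where

open import Data.Bool.Base using (Bool; true; false)
open import Data.Fin.Base using (Fin; zero; toℕ)
open import Data.Integer.Base as ℤ using (ℤ; +_; -[1+_]; 0ℤ)
open import Data.List.Base as List using (List; []; _∷_; [_]; _++_; map; head; last; replicate; tabulate)
open import Data.List.Membership.Propositional using (_∈_)
open import Data.List.Relation.Binary.BagAndSetEquality using (_∼[_]_; set)
open import Data.List.Relation.Binary.Disjoint.Propositional using (Disjoint)
open import Data.List.Relation.Unary.All using (All)
open import Data.List.Relation.Unary.Linked using (Linked)
open import Data.Maybe.Base using (just)
open import Data.Nat.Base using (ℕ; suc)
open import Data.Product.Base using (_×_; _,_; ∃-syntax)
open import Data.Sum.Base using (_⊎_; inj₁; inj₂)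
open import Data.Vec.Base as Vec using (Vec; []; _∷_)
open import Relation.Binary.PropositionalEquality.Core using (_≡_; _≢_)
open import Relation.Nullary.Negation.Core using (¬_)

------------------------------------------------------------------------
-- Vectors, cells, patterns

infixl 6 _⊕_ _⊖_

Vector : ℕ → Set
Vector d = Vec ℤ d

𝟎 : ∀ {d} → Vector d
𝟎 = Vec.replicate _ 0ℤ

_⊕_ : ∀ {d} → Vector d → Vector d → Vector d
_⊕_ = Vec.zipWith ℤ._+_

neg : ∀ {d} → Vector d → Vector d
neg = Vec.map (λ x → ℤ.- x)

_⊖_ : ∀ {d} → Vector d → Vector d → Vector d
u ⊖ v = u ⊕ neg v

-- The alphabet is Fin n.

record Cell (d n : ℕ) : Set where
  constructor ⟦_,_⟧
  field
    vec  : Vector d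
    type : Fin n

open Cell public

translateCell : ∀ {d n} → Vector d → Cell d n → Cell d n
translateCell w c = ⟦ w ⊕ vec c , type c ⟧

translate : ∀ {d n} → Vector d → List (Cell d n) → List (Cell d n)
translate w = map (translateCell w)

supp : ∀ {d n} → List (Cell d n) → List (Vector d)
supp = map vec

SingleValued : ∀ {d n} → List (Cell d n) → Set
SingleValued cs = ∀ {c c'} → c ∈ cs → c' ∈ cs → vec c ≡ vec c' → c ≡ c'

-- Finite sets are presented by lists; order and repetitions carry no
-- meaning, since only membership is ever used.

record Pattern (d n : ℕ) : Set where
  field
    cells        : List (Cell d n)
    singleValued : SingleValued cells

open Pattern public

------------------------------------------------------------------------
-- Substitutions

-- The concatenation rule (left , right , offset) ↦ image.

record Rule (d n : ℕ) : Set where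
  field
    left right   : Fin n
    offset image : Vector d

open Rule public

record Substitution (d n : ℕ) : Set where
  field
    base          : Fin n → Pattern d n
    rules         : List (Rule d n)
    offset≢𝟎      : ∀ {r} → r ∈ rules → offset r ≢ 𝟎
    deterministic : ∀ {r r'} → r ∈ rules → r' ∈ rules →
      (left r' ≡ left r × right r' ≡ right r × offset r' ≡ offset r) ⊎
      (left r' ≡ right r × right r' ≡ left r × offset r' ≡ neg (offset r)) →
      r' ≡ r

open Substitution public

module _ {d n : ℕ} (σ : Substitution d n) where

  startingPatterns : List (List (Cell d n))
  startingPatterns =
    map (λ r → ⟦ 𝟎 , left r ⟧ ∷ ⟦ offset r , right r ⟧ ∷ []) (rules σ)

  baseImage : Cell d n → List (Cell d n)
  baseImage c = cells (base σ (type c))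

  -- RuleImage c c' v : the partial function σ_rule is defined at (c , c')
  -- and its value there is v.

  data RuleImage (c c' : Cell d n) : Vector d → Set where
    forward  : ∀ {r} → r ∈ rules σ →
               left r ≡ type c → right r ≡ type c' →
               offset r ≡ vec c' ⊖ vec c →
               RuleImage c c' (image r)
    backward : ∀ {r} → r ∈ rules σ →
               left r ≡ type c' → right r ≡ type c →
               offset r ≡ vec c ⊖ vec c' →
               RuleImage c c' (neg (image r))

  ----------------------------------------------------------------------
  -- Paths

  Neighbours : Cell d n → Cell d n → Set
  Neighbours c c' = ∃[ S ] ∃[ w ]
    (S ∈ startingPatterns × (c ∷ c' ∷ []) ∼[ set ] translate w S)

  record Path (c c' : Cell d n) (γ : List (Cell d n)) : Set where
    field
      starts       : head γ ≡ just c
      ends         : last γ ≡ just c'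
      linked       : Linked Neighbours γ
      singleValued : SingleValued γ

  PathOf : Pattern d n → Cell d n → Cell d n → List (Cell d n) → Set
  PathOf P c c' γ = Path c c' γ × All (_∈ cells P) γ

  Covered : Pattern d n → Set
  Covered P = ∀ {c c'} → c ∈ cells P → c' ∈ cells P → ∃[ γ ] PathOf P c c' γ

  -- ImageVector γ w : ω_σ(γ) = w.  On paths this relation is total and
  -- functional, because neighbouring cells match exactly one rule.

  data ImageVector : List (Cell d n) → Vector d → Set where
    single : ∀ {c} → ImageVector [ c ] 𝟎
    step   : ∀ {c c' γ v w} → RuleImage c c' v → ImageVector (c' ∷ γ) w →
             ImageVector (c ∷ c' ∷ γ) (v ⊕ w)

  ----------------------------------------------------------------------
  -- Consistency and overlapping

  ConsistentOn : Pattern d n → Set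
  ConsistentOn P = ∀ {c c' γ γ' w w'} → c ∈ cells P → c' ∈ cells P →
    PathOf P c c' γ → PathOf P c c' γ' →
    ImageVector γ w → ImageVector γ' w' → w ≡ w'

  NonOverlappingOn : Pattern d n → Set
  NonOverlappingOn P = ∀ {c c' γ w} → c ∈ cells P → c' ∈ cells P → c ≢ c' →
    PathOf P c c' γ → ImageVector γ w →
    Disjoint (supp (baseImage c)) (supp (translate w (baseImage c')))

  Consistent : Set
  Consistent = ∀ P → Covered P → ConsistentOn P

  NonOverlapping : Set
  NonOverlapping = ∀ P → Covered P → NonOverlappingOn P

  Overlapping : Set
  Overlapping = ¬ NonOverlapping

------------------------------------------------------------------------
-- Algorithms

-- Register machines over words: finitely many states and finitely many
-- registers, each holding a binary word that is accessed as a stack.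
-- This is a Turing-complete model: a one-tape Turing machine is simulated
-- by keeping the two halves of its tape in two registers, with tape
-- symbols written as blocks of bits.

Word : Set
Word = List Bool

data Instruction (states registers : ℕ) : Set where
  push : Fin registers → Bool → Fin states → Instruction states registers
  -- The continuations are for the empty word, for a removed first letter
  -- false, and for a removed first letter true.
  pop  : Fin registers → (ifEmpty ifFalse ifTrue : Fin states) →
         Instruction states registers
  halt : Bool → Instruction states registers

-- The number of states and the number of registers are the successors
-- of the fields, so that state zero and register zero exist.

record Machine : Set where
  field
    states    : ℕ
    registers : ℕ
    program   : Fin (suc states) → Instruction (suc states) (suc registers)

module _ (M : Machine) where
  open Machine M

  Configuration : Set
  Configuration = Fin (suc states) × Vec Word (suc registers)

  popInto : Fin (suc registers) → (ifEmpty ifFalse ifTrue : Fin (suc states)) →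
            Word → Vec Word (suc registers) → Configuration
  popInto i p q r []          R = p , R
  popInto i p q r (false ∷ w) R = q , R Vec.[ i ]≔ w
  popInto i p q r (true  ∷ w) R = r , R Vec.[ i ]≔ w

  execute : Instruction (suc states) (suc registers) →
            Vec Word (suc registers) → Bool ⊎ Configuration
  execute (halt b)      R = inj₁ b
  execute (push i b q)  R = inj₂ (q , R Vec.[ i ]≔ (b ∷ Vec.lookup R i))
  execute (pop i p q r) R = inj₂ (popInto i p q r (Vec.lookup R i) R)

  -- HaltsWith κ b : the run from κ terminates with verdict b.

  data HaltsWith : Configuration → Bool → Set where
    stop : ∀ {q R b} → execute (program q) R ≡ inj₁ b → HaltsWith (q , R) b
    next : ∀ {q R κ b} → execute (program q) R ≡ inj₂ κ → HaltsWith κ b →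
           HaltsWith (q , R) b

  initial : Word → Configuration
  initial w = zero , w ∷ Vec.replicate registers []

  Outputs : Word → Bool → Set
  Outputs w = HaltsWith (initial w)

------------------------------------------------------------------------
-- Substitutions as inputs

-- Every encoder below is a prefix code, so concatenated encodings can be
-- parsed unambiguously: natural numbers are in unary with end marker
-- false, integers are a sign bit and a natural number, and in a list each
-- element is announced by true and the end is marked by false.

encodeℕ : ℕ → Word
encodeℕ k = replicate k true ++ [ false ]

encodeℤ : ℤ → Word
encodeℤ (+ k)    = false ∷ encodeℕ k
encodeℤ -[1+ k ] = true ∷ encodeℕ k

encodeList : ∀ {A : Set} → (A → Word) → List A → Word
encodeList f []       = [ false ]
encodeList f (x ∷ xs) = true ∷ f x ++ encodeList f xs

encodeFin : ∀ {n} → Fin n → Word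
encodeFin t = encodeℕ (toℕ t)

-- No end marker is needed, as the dimension is fixed.

encodeVector : ∀ {d} → Vector d → Word
encodeVector []      = []
encodeVector (x ∷ v) = encodeℤ x ++ encodeVector v

encodeCell : ∀ {d n} → Cell d n → Word
encodeCell c = encodeVector (vec c) ++ encodeFin (type c)

encodePattern : ∀ {d n} → Pattern d n → Word
encodePattern P = encodeList encodeCell (cells P)

encodeRule : ∀ {d n} → Rule d n → Word
encodeRule r = encodeFin (left r) ++ encodeFin (right r) ++
               encodeVector (offset r) ++ encodeVector (image r)

-- The size of the alphabet is the length of the list of base patterns.

encode : ∀ {d n} → Substitution d n → Word
encode σ = encodeList encodePattern (tabulate (base σ)) ++
           encodeList encodeRule (rules σ)

{-# OPTIONS --safe #-}

-- Against a decision procedure M stands a substitution which simulates M on the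
-- encoding of the substitution itself and overlaps iff M answers that it does not.
--
-- Given a register machine N, the types of the cells are chosen such that each
-- of them determines the offset by which it is entered and the one by which it
-- is left, so that every component of a pattern is a chain.  The chain from a
-- start cell zigzags over a tape, one row above the other.  To write a letter b
-- it occupies, of the positions assigned to the letters in that column, all but
-- the one of b; to read a letter a in the next row it occupies the position of
-- a.  As a pattern has only one cell at each position, the letter read is the
-- letter written, and the rows are forced to be the configurations of N on an
-- input 1ⁿ, where n is guessed in the bottom row and fixes the right end of the
-- tape.  The chain reaches a final cell, at the right end, exactly if N halts
-- with verdict false.
--
-- The image of a rule is the horizontal part of its offset, whence σ X is
-- consistent and ω is the difference of the columns of the ends of a path.  Only
-- the start type, with the site (X , 0), and the final types, with the site
-- (0 , 0), have nonempty base patterns.  So σ X overlaps iff N halts with verdict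
-- false on 1ⁿ for n = X − 1.
--
-- X occurs in the encoding of σ X only as a block of X letters true before a
-- word w that depends on N alone.  Let N be the machine that on input 1ⁿ
-- produces the n-th word in an enumeration, puts this block and the constant
-- first letters in front of it, and then runs M.  If n is the number of w, then
-- N on 1ⁿ runs M on the encoding of σ (n + 1).
module Submission where

open import Defs
open import Data.Bool.Base using (Bool; true; false; if_then_else_; _∧_)
open import Data.Empty using (⊥-elim)
open import Data.Fin.Base using (Fin; zero; suc; toℕ; fromℕ; inject₁; _↑ʳ_)
open import Data.Fin.Induction using (<-weakInduction)
open import Data.Fin.Patterns
open import Data.Fin.Properties as Fin
  using (*↔×; +↔⊎; 2↔Bool; toℕ-injective; toℕ<n; toℕ-fromℕ; toℕ-inject₁; fromℕ≢inject₁;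
         inject₁-injective)
open import Data.Integer.Base as ℤ using (ℤ; +_; 0ℤ; 1ℤ; -1ℤ)
import Data.Integer.Properties as ℤ
open import Algebra.Properties.AbelianGroup ℤ.+-0-abelianGroup using (∙-cancelˡ; ∙-cancelʳ)
open import Data.Integer.Tactic.RingSolver using (solve-∀)
open import Data.List.Base as List
  using (List; []; _∷_; [_]; _++_; _ʳ++_; map; concatMap; head; last; replicate; reverse; allFin; length)
open import Data.List.Membership.Propositional using (_∈_; find; lose)
open import Data.List.Membership.Propositional.Properties
  using (∈-map⁺; ∈-map⁻; ∈-++⁻; ∈-++⁺ˡ; ∈-++⁺ʳ; ∈-concatMap⁺; ∈-concatMap⁻; ∈-allFin)
import Data.List.Properties as List
open import Data.List.Relation.Unary.All as All using (All; []; _∷_)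
open import Data.List.Relation.Unary.Any using (here; there)
open import Data.List.Relation.Unary.Linked using (Linked; [-]; _∷_)
open import Data.Maybe.Base using (Maybe; just; nothing; maybe′)
open import Data.Nat.Base as ℕ using (ℕ; zero; suc; _+_; _<_; _≤_; z≤n; s≤s)
open import Data.Nat.Induction using (<-wellFounded)
import Data.Nat.Properties as ℕ
open import Data.Product.Base using (_×_; _,_; proj₁; proj₂; ∃; ∃-syntax; Σ-syntax)
open import Data.Product.Function.NonDependent.Propositional using (_×-↔_)
open import Data.Sum.Base as Sum using (_⊎_; inj₁; inj₂)
open import Data.Sum.Function.Propositional using (_⊎-↔_)
open import Data.Unit.Base using (⊤; tt)
open import Data.Vec.Base as Vec using ([]; _∷_)
import Data.Vec.Properties as Vec
open import Function.Base using (_∘_; case_of_; id)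
open import Function.Bundles using (_↔_; Inverse; Equivalence; mk⇔)
open import Function.Construct.Composition using (_↔-∘_)
open import Function.Construct.Identity using (↔-id)
open import Induction.WellFounded using (Acc; acc)
open import Relation.Binary.Construct.Closure.ReflexiveTransitive as Star using (Star; ε; _◅_; _◅◅_)
open import Relation.Binary.Construct.Closure.Transitive as Plus using (TransClosure; _∷_)
open import Relation.Binary.PropositionalEquality hiding ([_])
open import Relation.Nullary.Decidable using (Dec; yes; no; does; dec-true; dec-false)
open import Relation.Nullary.Negation.Core using (¬_; contradiction)
open import Relation.Nullary.Reflects using (Reflects; ofʸ; ofⁿ)

-- Vectors in the plane.

pattern ⟪_,_⟫ x y = x ∷ y ∷ []

abscissa ordinate : Vector 2 → ℤ
abscissa ⟪ x , _ ⟫ = x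
ordinate ⟪ _ , y ⟫ = y

⟪⟫-cong : ∀ {x x' y y'} → x ≡ x' → y ≡ y' → _≡_ {A = Vector 2} ⟪ x , y ⟫ ⟪ x' , y' ⟫
⟪⟫-cong refl refl = refl

⊕-⊖ : ∀ (u v : Vector 2) → (u ⊕ v) ⊖ u ≡ v
⊕-⊖ ⟪ a , b ⟫ ⟪ c , d ⟫ = ⟪⟫-cong (lemma a c) (lemma b d)
  where
  lemma : ∀ a c → (a ℤ.+ c) ℤ.- a ≡ c
  lemma = solve-∀

⊕-cancelʳ : ∀ (u v w : Vector 2) → u ⊕ w ≡ v ⊕ w → u ≡ v
⊕-cancelʳ ⟪ a , b ⟫ ⟪ c , d ⟫ ⟪ e , f ⟫ eq =
  ⟪⟫-cong (∙-cancelʳ e a c (cong abscissa eq)) (∙-cancelʳ f b d (cong ordinate eq))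

⊕-identityʳ : ∀ (v : Vector 2) → v ⊕ 𝟎 ≡ v
⊕-identityʳ ⟪ a , b ⟫ = ⟪⟫-cong (ℤ.+-identityʳ a) (ℤ.+-identityʳ b)

horizontal : Vector 2 → Vector 2
horizontal ⟪ x , _ ⟫ = ⟪ x , 0ℤ ⟫

Rule-≡ : ∀ {n} {r r' : Rule 2 n} → left r ≡ left r' → right r ≡ right r' →
  offset r ≡ offset r' → image r ≡ image r' → r ≡ r'
Rule-≡ refl refl refl refl = refl

replicate-snoc : ∀ {A : Set} (a : A) n ys → replicate n a ++ (a ∷ ys) ≡ a ∷ replicate n a ++ ys
replicate-snoc a zero    ys = refl
replicate-snoc a (suc n) ys = cong (a ∷_) (replicate-snoc a n ys)

-- Consistency of substitutions with horizontal images.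

module _ {n} (σ : Substitution 2 n)
  (images : ∀ {r} → r ∈ rules σ → image r ≡ horizontal (offset r)) where

  private
    Δ : Cell 2 n → Cell 2 n → Vector 2
    Δ c c' = horizontal (vec c' ⊖ vec c)

    neg-Δ : ∀ (c c' : Cell 2 n) → neg (Δ c c') ≡ Δ c' c
    neg-Δ ⟦ ⟪ a , _ ⟫ , _ ⟧ ⟦ ⟪ b , _ ⟫ , _ ⟧ = ⟪⟫-cong (lemma a b) refl
      where
      lemma : ∀ a b → ℤ.- (b ℤ.- a) ≡ a ℤ.- b
      lemma = solve-∀

    Δ-self : ∀ (c : Cell 2 n) → Δ c c ≡ 𝟎
    Δ-self ⟦ ⟪ a , _ ⟫ , _ ⟧ = ⟪⟫-cong (ℤ.+-inverseʳ a) refl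

    Δ-trans : ∀ (c d e : Cell 2 n) → Δ c d ⊕ Δ d e ≡ Δ c e
    Δ-trans ⟦ ⟪ a , _ ⟫ , _ ⟧ ⟦ ⟪ b , _ ⟫ , _ ⟧ ⟦ ⟪ c , _ ⟫ , _ ⟧ = ⟪⟫-cong (lemma a b c) refl
      where
      lemma : ∀ a b c → (b ℤ.- a) ℤ.+ (c ℤ.- b) ≡ c ℤ.- a
      lemma = solve-∀

    rule-Δ : ∀ {c c' v} → RuleImage σ c c' v → v ≡ Δ c c'
    rule-Δ (forward r∈ _ _ o) = trans (images r∈) (cong horizontal o)
    rule-Δ {c} {c'} (backward r∈ _ _ o) =
      trans (cong neg (trans (images r∈) (cong horizontal o))) (neg-Δ c' c)

  -- The sum telescopes: traversed in either direction, a rule contributes the difference of the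
  -- abscissae of its two cells.
  imageVector-horizontal : ∀ {c c' γ w} → head γ ≡ just c → last γ ≡ just c' →
    ImageVector σ γ w → w ≡ horizontal (vec c' ⊖ vec c)
  imageVector-horizontal {c} refl refl single = sym (Δ-self c)
  imageVector-horizontal {c} {c'} refl l (step {c' = d} i is) =
    trans (cong₂ _⊕_ (rule-Δ i) (imageVector-horizontal refl l is)) (Δ-trans c d c')

  horizontal-consistent : Consistent σ
  horizontal-consistent P _ _ _ (p , _) (p' , _) i i' =
    trans (imageVector-horizontal (Path.starts p) (Path.ends p) i)
          (sym (imageVector-horizontal (Path.starts p') (Path.ends p') i'))

-- Enumerations of finite types.

_⊗_ : ∀ {B C : Set} {m n} → Fin m ↔ B → Fin n ↔ C → Fin (m ℕ.* n) ↔ (B × C)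
f ⊗ g = (f ×-↔ g) ↔-∘ *↔×

enumeration : ∀ {B : Set} {n} → Fin n ↔ B → List B
enumeration f = map (Inverse.to f) (allFin _)

∈-enumeration : ∀ {B : Set} {n} (f : Fin n ↔ B) b → b ∈ enumeration f
∈-enumeration f b = subst (_∈ enumeration f) (Inverse.strictlyInverseˡ f b)
  (∈-map⁺ (Inverse.to f) (∈-allFin (Inverse.from f b)))

-- Tiles, heights and rules.

data Move : Set where
  leftwards rightwards upwards : Move

-- In state s a letter a is read, out s a is written, and the head moves on into
-- the state next s a; move s is the move by which the state s is entered.

module ZigZag {S A : Set} {s l : ℕ} (S↔ : Fin (suc s) ↔ S) (A↔ : Fin (suc l) ↔ A)
  (out : S → A → A) (next : S → A → Maybe S) (move : S → Move) (accepting : S → Bool) where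

  L H : ℕ
  L = suc l
  H = suc (suc (L + L))

  Tile : Set
  Tile = S × A × Fin (3 + L)

  finish : Fin (3 + L)
  finish = fromℕ (2 + L)

  size : ℕ
  size = suc s ℕ.* (suc l ℕ.* (3 + L))

  Tile↔ : Fin size ↔ Tile
  Tile↔ = S↔ ⊗ (A↔ ⊗ ↔-id _)

  decode : Fin size → Tile
  decode = Inverse.to Tile↔

  code : Tile → Fin size
  code = Inverse.from Tile↔

  decode-code : ∀ t → decode (code t) ≡ t
  decode-code = Inverse.strictlyInverseˡ Tile↔

  code-decode : ∀ i → code (decode i) ≡ i
  code-decode = Inverse.strictlyInverseʳ Tile↔

  code-injective : ∀ {t t'} → code t ≡ code t' → t ≡ t'
  code-injective {t} {t'} eq =
    trans (sym (decode-code t)) (trans (cong decode eq) (decode-code t'))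

  start : S
  start = Inverse.to S↔ zero

  origin : A
  origin = Inverse.to A↔ zero

  index : A → ℕ
  index a = toℕ (Inverse.from A↔ a)

  index<L : ∀ a → index a < L
  index<L a = toℕ<n (Inverse.from A↔ a)

  index-injective : ∀ {a b} → index a ≡ index b → a ≡ b
  index-injective {a} {b} eq =
    trans (sym (Inverse.strictlyInverseˡ A↔ a))
      (trans (cong (Inverse.to A↔) (toℕ-injective eq)) (Inverse.strictlyInverseˡ A↔ b))

  -- The cells (s , a , k) of a tile form a chain in one column.  Heights are
  -- relative to the row that is read; the row that is written is H higher, and
  -- index a + index a is the position assigned to a.  After the entry, on top,
  -- and the cell that reads a there is one cell for each j ≤ L, at the position
  -- assigned to j unless j is the letter written, which bump avoids.  No letter
  -- has index L; so the height of the last cell does not depend on the tile.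

  bump : ℕ → A → ℕ
  bump j b = if does (j ℕ.≟ index b) then 1 else 0

  height : S → A → Fin (3 + L) → ℕ
  height s a zero          = H + suc (L + L)
  height s a (suc zero)    = index a + index a
  height s a (suc (suc j)) = H + (bump (toℕ j) (out s a) + (toℕ j + toℕ j))

  dx dy : Move → ℤ
  dx leftwards  = -1ℤ
  dx rightwards = 1ℤ
  dx upwards    = 0ℤ
  dy leftwards  = 0ℤ
  dy rightwards = 0ℤ
  dy upwards    = + H

  -- The offset by which a cell of this type is entered. At equal levels an entry lies one above the
  -- last cell of any tile, whence the summand `1ℤ`.
  shift : Tile → Vector 2
  shift (s , a , zero)  = ⟪ dx (move s) , dy (move s) ℤ.+ 1ℤ ⟫
  shift (s , a , suc k) = ⟪ 0ℤ , + height s a (suc k) ℤ.- + height s a (inject₁ k) ⟫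

  data _⊳_ : Tile → Tile → Set where
    inner : ∀ {s a} k → (s , a , inject₁ k) ⊳ (s , a , suc k)
    outer : ∀ {s a s'} a' → next s a ≡ just s' → (s , a , finish) ⊳ (s' , a' , zero)

  bump-self : ∀ b → bump (index b) b ≡ 1
  bump-self b = cong (if_then 1 else 0) (dec-true (index b ℕ.≟ index b) refl)

  bump-other : ∀ {j} b → j ≢ index b → bump j b ≡ 0
  bump-other {j} b j≢ = cong (if_then 1 else 0) (dec-false (j ℕ.≟ index b) j≢)

  bump≤1 : ∀ j b → bump j b ≤ 1
  bump≤1 j b with does (j ℕ.≟ index b)
  ... | true  = s≤s z≤n
  ... | false = z≤n

  -- `e` and `e'` are remainders modulo 2, `i` and `j` the quotients.
  double-injective : ∀ {e e'} i j → e ≤ 1 → e' ≤ 1 → e + (i + i) ≡ e' + (j + j) → i ≡ j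
  double-injective zero zero _ _ _ = refl
  double-injective zero (suc j) e≤ e'≤ eq = ⊥-elim (ℕ.<-irrefl eq (lemma e≤))
    where
    lemma : ∀ {e e'} → e ≤ 1 → e + 0 < e' + (suc j + suc j)
    lemma {e} {e'} e≤ = ℕ.<-≤-trans (s≤s (subst (_≤ 1) (sym (ℕ.+-identityʳ e)) e≤))
      (ℕ.≤-trans (s≤s (subst (1 ≤_) (sym (ℕ.+-suc j j)) (s≤s z≤n))) (ℕ.m≤n+m _ e'))
  double-injective (suc i) zero e≤ e'≤ eq = sym (double-injective zero (suc i) e'≤ e≤ (sym eq))
  double-injective {e} {e'} (suc i) (suc j) e≤ e'≤ eq =
    cong suc (double-injective i j e≤ e'≤ (ℕ.suc-injective (ℕ.suc-injective
      (trans (sym (lemma e i)) (trans eq (lemma e' j))))))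
    where
    lemma : ∀ e i → e + (suc i + suc i) ≡ suc (suc (e + (i + i)))
    lemma e i = trans (ℕ.+-suc e _) (cong suc (trans (cong (e ℕ.+_) (ℕ.+-suc i i)) (ℕ.+-suc e _)))

  double≤ : ∀ {i j} → i ≤ j → i + i ≤ j + j
  double≤ i≤j = ℕ.+-mono-≤ i≤j i≤j

  read<H : ∀ a → index a + index a < H
  read<H a = s≤s (ℕ.m≤n⇒m≤1+n (double≤ (ℕ.<⇒≤ (index<L a))))

  write-height : ∀ s a (j : Fin (suc L)) → height s a (suc (suc j)) ≤ H + (L + L)
  write-height s a j = ℕ.+-monoʳ-≤ H (aux (toℕ j ℕ.≟ index b))
    where
    b = out s a
    aux : _ → bump (toℕ j) b + (toℕ j + toℕ j) ≤ L + L
    -- The bump costs one, for which there is room because `index b < L`.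
    aux (yes eq) = ℕ.≤-trans (ℕ.+-monoˡ-≤ _ (bump≤1 (toℕ j) b))
      (ℕ.≤-trans (s≤s (ℕ.+-monoʳ-≤ (toℕ j) (ℕ.n≤1+n _)))
        (double≤ (subst (λ i → suc i ≤ L) (sym eq) (index<L b))))
    aux (no neq) rewrite bump-other b neq = double≤ (ℕ.≤-pred (toℕ<n j))

  height-finish : ∀ s a → height s a finish ≡ H + (L + L)
  height-finish s a = cong (H ℕ.+_) (trans
    (cong (λ i → bump i (out s a) + (i + i)) (toℕ-fromℕ L))
    (cong (ℕ._+ (L + L)) (bump-other (out s a) (λ eq → ℕ.<-irrefl (sym eq) (index<L (out s a))))))

  -- The reading cell lies below `H`, the writing cells from `H` to `H + (L + L)`, the entry just
  -- above them. Among the writing cells, halving recovers the index.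
  height-injective : ∀ s a {k k'} → height s a k ≡ height s a k' → k ≡ k'
  height-injective s a {zero}        {zero}          eq = refl
  height-injective s a {zero}        {suc zero}      eq = ⊥-elim (ℕ.<-irrefl (sym eq)
    (ℕ.<-≤-trans (read<H a) (ℕ.m≤m+n H _)))
  height-injective s a {zero}        {suc (suc j)}   eq = ⊥-elim (ℕ.<-irrefl (sym eq)
    (ℕ.≤-<-trans (write-height s a j) (ℕ.+-monoʳ-< H (ℕ.n<1+n _))))
  height-injective s a {suc zero}    {suc zero}      eq = refl
  height-injective s a {suc zero}    {suc (suc j)}   eq = ⊥-elim (ℕ.<-irrefl eq
    (ℕ.<-≤-trans (read<H a) (ℕ.m≤m+n H _)))
  height-injective s a {suc (suc i)} {suc (suc j)}   eq =
    cong (λ k → Fin.suc (Fin.suc k)) (toℕ-injective (double-injective (toℕ i) (toℕ j)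
      (bump≤1 (toℕ i) (out s a)) (bump≤1 (toℕ j) (out s a)) (ℕ.+-cancelˡ-≡ H _ _ eq)))
  height-injective s a {suc zero}    {zero}          eq =
    sym (height-injective s a {zero} {suc zero} (sym eq))
  height-injective s a {suc (suc j)} {zero}          eq =
    sym (height-injective s a {zero} {suc (suc j)} (sym eq))
  height-injective s a {suc (suc j)} {suc zero}      eq =
    sym (height-injective s a {suc zero} {suc (suc j)} (sym eq))

  innerRule : S × A × Fin (2 + L) → Rule 2 size
  rule : Tile → Tile → Rule 2 size
  rule t t' = record
    { left   = code t
    ; right  = code t'
    ; offset = shift t'
    ; image  = horizontal (shift t')
    }
  innerRule (s , a , k) = rule (s , a , inject₁ k) (s , a , suc k)

  -- The letter `a'` of the entered tile is arbitrary: rules do not see the tape, and only the clash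
  -- of cells in `read` enforces the right letter.
  outerRules : S × A × A → List (Rule 2 size)
  outerRules (s , a , a') =
    maybe′ (λ s' → [ rule (s , a , finish) (s' , a' , zero) ]) [] (next s a)

  innerSteps↔ : Fin (suc s ℕ.* (suc l ℕ.* (2 + L))) ↔ (S × A × Fin (2 + L))
  innerSteps↔ = S↔ ⊗ (A↔ ⊗ ↔-id _)

  outerSteps↔ : Fin (suc s ℕ.* (suc l ℕ.* suc l)) ↔ (S × A × A)
  outerSteps↔ = S↔ ⊗ (A↔ ⊗ A↔)

  allRules : List (Rule 2 size)
  allRules = map innerRule (enumeration innerSteps↔) ++ concatMap outerRules (enumeration outerSteps↔)

  ∈-allRules⁺ : ∀ {t t'} → t ⊳ t' → rule t t' ∈ allRules
  ∈-allRules⁺ (inner {s} {a} k) =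
    ∈-++⁺ˡ (∈-map⁺ innerRule (∈-enumeration innerSteps↔ (s , a , k)))
  ∈-allRules⁺ (outer {s} {a} {s'} a' eq) =
    ∈-++⁺ʳ (map innerRule (enumeration innerSteps↔))
      (∈-concatMap⁺ outerRules (lose (∈-enumeration outerSteps↔ (s , a , a')) r∈))
    where
    r∈ : rule (s , a , finish) (s' , a' , zero) ∈ outerRules (s , a , a')
    r∈ rewrite eq = here refl

  ∈-allRules⁻ : ∀ {r} → r ∈ allRules → ∃[ t ] ∃[ t' ] (t ⊳ t' × r ≡ rule t t')
  ∈-allRules⁻ r∈ with ∈-++⁻ (map innerRule (enumeration innerSteps↔)) r∈
  ... | inj₁ r∈ˡ with ∈-map⁻ innerRule r∈ˡ
  ...   | (s , a , k) , _ , refl = _ , _ , inner k , refl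
  ∈-allRules⁻ {r} r∈ | inj₂ r∈ʳ with find (∈-concatMap⁻ outerRules {xs = enumeration outerSteps↔} r∈ʳ)
  ...   | (s , a , a') , _ , r∈' = aux (next s a) refl r∈'
    where
    aux : ∀ m → next s a ≡ m →
      r ∈ maybe′ (λ s' → [ rule (s , a , finish) (s' , a' , zero) ]) [] m →
      ∃[ t ] ∃[ t' ] (t ⊳ t' × r ≡ rule t t')
    aux (just s') eq (here refl) = _ , _ , outer a' eq , refl

  -- Heights within a tile are distinct, and between tiles the ordinate is positive.
  shift≢𝟎 : ∀ {t t'} → t ⊳ t' → shift t' ≢ 𝟎
  shift≢𝟎 (inner {s} {a} k) eq = ℕ.<-irrefl
    (trans (sym (toℕ-inject₁ k))
      (cong toℕ (sym (height-injective s a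
        (ℤ.+-injective (ℤ.i-j≡0⇒i≡j _ (+ height s a (inject₁ k)) (cong ordinate eq)))))))
    (ℕ.n<1+n (toℕ k))
  shift≢𝟎 (outer {s' = s'} a' _) eq with move s'
  shift≢𝟎 (outer a' _) () | leftwards
  shift≢𝟎 (outer a' _) () | rightwards
  shift≢𝟎 (outer a' _) () | upwards

  phase : Tile → ℕ
  phase (_ , _ , k) = toℕ k

  ⊳-phase : ∀ {t t'} → t ⊳ t' → phase t' ≡ suc (phase t) ⊎ (phase t ≡ 2 + L × phase t' ≡ 0)
  ⊳-phase (inner k)   = inj₁ (cong suc (sym (toℕ-inject₁ k)))
  ⊳-phase (outer _ _) = inj₂ (toℕ-fromℕ (2 + L) , refl)

  -- A step raises the phase by one modulo `3 + L`, which is more than 2. This excludes two rules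
  -- with exchanged sides.
  ⊳-antisym : ∀ {t t'} → t ⊳ t' → ¬ (t' ⊳ t)
  ⊳-antisym p q with ⊳-phase p | ⊳-phase q
  ... | inj₁ i | inj₁ j =
    ℕ.<-irrefl (trans j (cong suc i)) (ℕ.m≤n⇒m≤1+n (ℕ.n<1+n _))
  ... | inj₁ i | inj₂ (j , j') = case trans (sym j) (trans i (cong suc j')) of λ ()
  ... | inj₂ (i , i') | inj₁ j = case trans (sym i) (trans j (cong suc i')) of λ ()
  ... | inj₂ (i , i') | inj₂ (j , j') = case trans (sym i) j' of λ ()

  -- The substitution and its encoding.

  isFinal : Tile → Bool
  isFinal (s , a , k) = accepting s ∧ does (k Fin.≟ finish)

  site : ∀ {n} → ℕ → Fin (suc n) → Pattern 2 (suc n)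
  site X i = record
    { cells        = [ ⟦ ⟪ + X , 0ℤ ⟫ , i ⟧ ]
    ; singleValued = λ where (here refl) (here refl) _ → refl
    }

  empty : ∀ {n} → Pattern 2 n
  empty = record { cells = [] ; singleValued = λ () }

  basePattern : ℕ → Fin size → Pattern 2 size
  basePattern X zero    = site X zero
  basePattern X (suc i) = if isFinal (decode (suc i)) then site 0 zero else empty

  σ : ℕ → Substitution 2 size
  σ X = record
    { base          = basePattern X
    ; rules         = allRules
    ; offset≢𝟎      = offset≢𝟎'
    ; deterministic = deterministic'
    }
    where
    offset≢𝟎' : ∀ {r} → r ∈ allRules → offset r ≢ 𝟎
    offset≢𝟎' r∈ with ∈-allRules⁻ r∈
    ... | _ , _ , p , refl = shift≢𝟎 p

    deterministic' : ∀ {r r'} → r ∈ allRules → r' ∈ allRules →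
      (left r' ≡ left r × right r' ≡ right r × offset r' ≡ offset r) ⊎
      (left r' ≡ right r × right r' ≡ left r × offset r' ≡ neg (offset r)) →
      r' ≡ r
    deterministic' r∈ r'∈ same with ∈-allRules⁻ r∈ | ∈-allRules⁻ r'∈ | same
    ... | _ , _ , p , refl | _ , _ , p' , refl | inj₁ (i , j , k) =
      Rule-≡ i j k (cong horizontal k)
    ... | _ , _ , p , refl | _ , _ , p' , refl | inj₂ (i , j , _) =
      contradiction p' (subst₂ (λ u v → ¬ (u ⊳ v)) (sym (code-injective i)) (sym (code-injective j))
        (⊳-antisym p))

  σ-images : ∀ X {r} → r ∈ rules (σ X) → image r ≡ horizontal (offset r)
  σ-images X r∈ with ∈-allRules⁻ r∈
  ... | _ , _ , _ , refl = refl

  σ-consistent : ∀ X → Consistent (σ X)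
  σ-consistent X = horizontal-consistent (σ X) (σ-images X)

  -- X occurs only in the base pattern of type zero, which comes first.

  remainder : Word
  remainder = List.drop 3 (encode (σ 0))

  encode-σ : ∀ X → encode (σ X) ≡ true ∷ true ∷ false ∷ replicate X true ++ remainder
  encode-σ X = cong (λ w → true ∷ true ∷ false ∷ w) (assoc [ false ] _ _ _ _ _)
    where
    ts = replicate X true

    -- By computation the encoding is a left-nested concatenation whose innermost block is `ts`; it
    -- remains to reassociate.
    assoc : ∀ a b c d e f → (((((ts ++ a) ++ b) ++ c) ++ d) ++ e) ++ f
      ≡ ts ++ ((((a ++ b) ++ c) ++ d) ++ e) ++ f
    assoc a b c d e f
      rewrite List.++-assoc ts a b
            | List.++-assoc ts (a ++ b) c
            | List.++-assoc ts ((a ++ b) ++ c) d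
            | List.++-assoc ts (((a ++ b) ++ c) ++ d) e
      = List.++-assoc ts ((((a ++ b) ++ c) ++ d) ++ e) f

  -- Directed steps between cells.

  ⊳-shift : ∀ {t u t' u'} → t ⊳ t' → u ⊳ u' → t ≡ u → shift t' ≡ shift u'
  ⊳-shift (inner {s} {a} k) (inner k') eq with cong proj₁ eq | cong (proj₁ ∘ proj₂) eq
  ... | refl | refl =
    cong (λ k → shift (s , a , suc k)) (inject₁-injective (cong (proj₂ ∘ proj₂) eq))
  ⊳-shift (inner k) (outer _ _) eq = ⊥-elim (fromℕ≢inject₁ (sym (cong (proj₂ ∘ proj₂) eq)))
  ⊳-shift (outer _ _) (inner k) eq = ⊥-elim (fromℕ≢inject₁ (cong (proj₂ ∘ proj₂) eq))
  ⊳-shift (outer _ p) (outer _ q) refl with trans (sym p) q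
  ... | refl = refl

  infix 4 _⟶_

  data _⟶_ (c d : Cell 2 size) : Set where
    step : ∀ {t t'} → t ⊳ t' → type c ≡ code t → type d ≡ code t' →
           vec d ≡ vec c ⊕ shift t' → c ⟶ d

  neighbours⁻ : ∀ {X c d} → Neighbours (σ X) c d → c ⟶ d ⊎ d ⟶ c
  neighbours⁻ {X} {c} {d} (_ , w , S∈ , same)
    with ∈-map⁻ (λ r → ⟦ 𝟎 , left r ⟧ ∷ ⟦ offset r , right r ⟧ ∷ []) {xs = allRules} S∈
  ... | r , r∈ , refl with ∈-allRules⁻ r∈
  ... | t , t' , p , refl =
    aux (Equivalence.to (same {c}) (here refl)) (Equivalence.to (same {d}) (there (here refl)))
      (Equivalence.from (same {u}) (here refl)) (Equivalence.from (same {v}) (there (here refl)))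
    where
    u v : Cell 2 size
    u = ⟦ w ⊕ 𝟎 , code t ⟧
    v = ⟦ w ⊕ shift t' , code t' ⟧

    u⟶v : u ⟶ v
    u⟶v = step p refl refl (cong (_⊕ shift t') (sym (⊕-identityʳ w)))

    aux : c ∈ u ∷ v ∷ [] → d ∈ u ∷ v ∷ [] → u ∈ c ∷ d ∷ [] → v ∈ c ∷ d ∷ [] → c ⟶ d ⊎ d ⟶ c
    -- Equality as sets admits repetitions. If `c` and `d` are the same cell, then `u` and `v`
    -- coincide as well.
    aux (here refl) (here refl) _ (here eq)            = inj₁ (subst (u ⟶_) eq u⟶v)
    aux (here refl) (here refl) _ (there (here eq))    = inj₁ (subst (u ⟶_) eq u⟶v)
    aux (here refl) (there (here refl)) _ _            = inj₁ u⟶v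
    aux (there (here refl)) (here refl) _ _            = inj₂ u⟶v
    aux (there (here refl)) (there (here refl)) (here eq) _         = inj₁ (subst (_⟶ v) eq u⟶v)
    aux (there (here refl)) (there (here refl)) (there (here eq)) _ = inj₁ (subst (_⟶ v) eq u⟶v)

  ⟶-neighbours : ∀ {X c d} → c ⟶ d → Neighbours (σ X) c d × Neighbours (σ X) d c
  ⟶-neighbours {X} {c} {d} (step {t} {t'} p refl refl eq) =
    (pair , vec c , pair∈ , λ {x} → mk⇔ (subst (x ∈_) same) (subst (x ∈_) (sym same))) ,
    (pair , vec c , pair∈ , λ {x} → mk⇔ (subst (x ∈_) same ∘ swap) (swap ∘ subst (x ∈_) (sym same)))
    where
    pair : List (Cell 2 size)
    pair = ⟦ 𝟎 , code t ⟧ ∷ ⟦ shift t' , code t' ⟧ ∷ []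

    pair∈ : pair ∈ startingPatterns (σ X)
    pair∈ = ∈-map⁺ _ (∈-allRules⁺ p)

    same : c ∷ d ∷ [] ≡ translate (vec c) pair
    same = cong₂ (λ u v → ⟦ u , code t ⟧ ∷ ⟦ v , code t' ⟧ ∷ []) (sym (⊕-identityʳ (vec c))) eq

    swap : ∀ {B : Set} {x y z : B} → x ∈ y ∷ z ∷ [] → x ∈ z ∷ y ∷ []
    swap (here eq)         = there (here eq)
    swap (there (here eq)) = here eq

  ⟶-ruleImage : ∀ {X c d} → c ⟶ d → ∃ (RuleImage (σ X) c d) × ∃ (RuleImage (σ X) d c)
  ⟶-ruleImage {c = c} (step {t} {t'} p refl refl eq) =
    (_ , forward (∈-allRules⁺ p) refl refl offset-eq) ,
    (_ , backward (∈-allRules⁺ p) refl refl offset-eq)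
    where
    offset-eq = sym (trans (cong (_⊖ vec c) eq) (⊕-⊖ (vec c) (shift t')))

  -- Non-overlapping by the absence of chains.

  Initial Final : ℕ → Fin size → Vector 2 → Set
  Initial X i v = i ≡ zero × v ≡ ⟪ + X , 0ℤ ⟫
  Final   X i v = isFinal (decode i) ≡ true × v ≡ 𝟎

  supp-base : ∀ X i {v} → v ∈ supp (cells (basePattern X i)) → Initial X i v ⊎ Final X i v
  supp-base X zero    (here refl) = inj₁ (refl , refl)
  supp-base X (suc i) v∈ with isFinal (decode (suc i))
  supp-base X (suc i) (here refl) | true = inj₂ (refl , refl)

  supp-translate : ∀ {w v : Vector 2} cs → v ∈ supp {n = size} (translate w cs) → ∃[ u ] (u ∈ supp cs × v ≡ w ⊕ u)
  supp-translate (c ∷ cs) (here eq)  = vec c , here refl , eq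
  supp-translate (c ∷ cs) (there v∈) with supp-translate cs v∈
  ... | u , u∈ , eq = u , there u∈ , eq

  -- When two images meet, the columns of the cells differ by the difference of the abscissae of
  -- their sites.
  abscissa-shift : ∀ p q u {v w : Vector 2} → w ≡ horizontal (q ⊖ p) → v ≡ w ⊕ u →
    abscissa q ℤ.+ abscissa u ≡ abscissa p ℤ.+ abscissa v
  abscissa-shift ⟪ a , _ ⟫ ⟪ b , _ ⟫ ⟪ e , _ ⟫ refl refl = lemma a b e
    where
    lemma : ∀ a b e → b ℤ.+ e ≡ a ℤ.+ ((b ℤ.- a) ℤ.+ e)
    lemma = solve-∀

  module Linear (next≢start : ∀ s a → next s a ≢ just start)
    (accepting-stuck : ∀ s a → accepting s ≡ true → next s a ≡ nothing) where

    -- Type zero is an entry in the start state, and entries are reached only through `next`.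
    initial-cell : ∀ {c d} → c ⟶ d → type d ≢ zero
    initial-cell (step (inner _) _ eq _) z with trans (sym (decode-code _)) (cong decode (trans (sym eq) z))
    ... | ()
    initial-cell (step (outer _ p) _ eq _) z with trans (sym (decode-code _)) (cong decode (trans (sym eq) z))
    ... | refl = next≢start _ _ p

    final-cell : ∀ {c d} → c ⟶ d → isFinal (decode (type c)) ≢ true
    final-cell (step {t} p refl _ _) f = aux p (subst (λ t → isFinal t ≡ true) (decode-code t) f)
      where
      aux : ∀ {t t'} → t ⊳ t' → isFinal t ≢ true
      aux (inner {s} k) f with accepting s
      ... | true with trans (sym f) (dec-false (inject₁ k Fin.≟ finish) (fromℕ≢inject₁ ∘ sym))
      ...   | ()
      aux (outer {s} {a} _ p) f with accepting s in eq
      ... | true with trans (sym p) (accepting-stuck s a eq)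
      ...   | ()

    module _ (P : Pattern 2 size) where

      data Chain (e : Cell 2 size) : ℕ → Cell 2 size → Set where
        []  : Chain e 0 e
        _∷_ : ∀ {n c d} → (c ⟶ d) × d ∈ cells P → Chain e n d → Chain e (suc n) c

      -- The type of a cell fixes the offset by which it is entered, hence the position of its
      -- predecessor; a pattern has one cell there.
      predecessor-unique : ∀ {c c' d} → c ∈ cells P → c' ∈ cells P → c ⟶ d → c' ⟶ d → c ≡ c'
      predecessor-unique {c} {c'} c∈ c'∈ (step {t' = t} _ _ i x) (step _ _ i' x')
        with code-injective (trans (sym i) i')
      ... | refl = singleValued P c∈ c'∈ (⊕-cancelʳ (vec c) (vec c') (shift t) (trans (sym x) x'))

      -- The type of the successor is not determined, since its letter is guessed, but its position
      -- is: `shift` of an entry ignores the letter.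
      successor-unique : ∀ {c d d'} → d ∈ cells P → d' ∈ cells P → c ⟶ d → c ⟶ d' → d ≡ d'
      successor-unique {c} d∈ d'∈ (step p i _ x) (step p' i' _ x') =
        singleValued P d∈ d'∈ (trans x (trans
          (cong (vec c ⊕_) (⊳-shift p p' (code-injective (trans (sym i) i')))) (sym x')))

      snoc : ∀ {n c d e} → Chain d n c → d ⟶ e → e ∈ cells P → Chain e (suc n) c
      snoc []      p e∈ = (p , e∈) ∷ []
      snoc (q ∷ γ) p e∈ = q ∷ snoc γ p e∈

      unsnoc : ∀ {n c e} → c ∈ cells P → Chain e n c →
        c ≡ e ⊎ ∃[ m ] ∃[ d ] (Chain d m c × d ∈ cells P × d ⟶ e)
      unsnoc c∈ []            = inj₁ refl
      unsnoc c∈ ((p , d∈) ∷ γ) with unsnoc d∈ γ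
      ... | inj₁ refl                = inj₂ (_ , _ , [] , c∈ , p)
      ... | inj₂ (_ , d , γ' , d∈' , q) = inj₂ (_ , d , (p , d∈) ∷ γ' , d∈' , q)

      Comparable : Cell 2 size → Cell 2 size → Set
      Comparable c d = ∃[ n ] (Chain d n c ⊎ Chain c n d)

      -- A path may go back and forth; by uniqueness of neighbours each of its steps lengthens or
      -- shortens one directed chain.
      comparable-step : ∀ {c c' d} → c ∈ cells P → c' ∈ cells P → d ∈ cells P →
        c ⟶ c' ⊎ c' ⟶ c → Comparable c' d → Comparable c d
      comparable-step c∈ c'∈ d∈ (inj₁ p) (n , inj₁ γ) = _ , inj₁ ((p , c'∈) ∷ γ)
      comparable-step c∈ c'∈ d∈ (inj₁ p) (n , inj₂ γ) with unsnoc d∈ γ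
      ... | inj₁ refl = _ , inj₁ ((p , c'∈) ∷ [])
      ... | inj₂ (_ , _ , γ' , x∈ , q) with predecessor-unique x∈ c∈ q p
      ...   | refl = _ , inj₂ γ'
      comparable-step c∈ c'∈ d∈ (inj₂ p) (_ , inj₁ []) = _ , inj₂ ((p , c∈) ∷ [])
      comparable-step c∈ c'∈ d∈ (inj₂ p) (_ , inj₁ ((q , x∈) ∷ γ)) with successor-unique x∈ c∈ q p
      ... | refl = _ , inj₁ γ
      comparable-step c∈ c'∈ d∈ (inj₂ p) (_ , inj₂ γ) = _ , inj₂ (snoc γ p c∈)

      comparable : ∀ {X c d γ} → d ∈ cells P → head γ ≡ just c → last γ ≡ just d →
        Linked (Neighbours (σ X)) γ → All (_∈ cells P) γ → Comparable c d
      comparable d∈ refl refl [-]     _          = 0 , inj₁ []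
      comparable {X} d∈ refl l (p ∷ γ) (c∈ ∷ c'∈ ∷ all) =
        comparable-step c∈ c'∈ d∈ (neighbours⁻ {X} p) (comparable {X} d∈ refl l γ (c'∈ ∷ all))

    -- A final cell has no successor and an initial cell no predecessor.
    chain-ends : ∀ P {X c d n u v} → c ∈ cells P → c ≢ d → Chain P d n c →
      Initial X (type c) u ⊎ Final X (type c) u → Initial X (type d) v ⊎ Final X (type d) v →
      Initial X (type c) u × Final X (type d) v
    chain-ends P c∈ c≢d []            _              _              = contradiction refl c≢d
    chain-ends P c∈ c≢d ((p , _) ∷ _) (inj₂ (f , _)) _              = contradiction f (final-cell p)
    chain-ends P c∈ c≢d γ@(_ ∷ _)     (inj₁ i)       (inj₂ f)       = i , f
    chain-ends P c∈ c≢d γ@(_ ∷ _)     (inj₁ i)       (inj₁ (z , _)) with unsnoc P c∈ γ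
    ... | inj₁ eq                  = contradiction eq c≢d
    ... | inj₂ (_ , _ , _ , _ , p) = contradiction z (initial-cell p)

    -- Two cells whose images meet are the ends of a chain from an initial to a final cell, and the
    -- sites put the latter `X` columns to the right.
    nonOverlapping : ∀ X →
      (∀ P {c e n} → c ∈ cells P → type c ≡ zero → isFinal (decode (type e)) ≡ true →
        abscissa (vec e) ≡ abscissa (vec c) ℤ.+ + X → ¬ Chain P e n c) →
      NonOverlapping (σ X)
    nonOverlapping X noChain P _ {c} {d} {w = w} c∈ d∈ c≢d (path , all) im (v∈ , v∈')
      with supp-translate (cells (base (σ X) (type d))) v∈'
    ... | u , u∈ , v≡ with comparable P {X} d∈ (Path.starts path) (Path.ends path) (Path.linked path) all
    ... | _ , inj₁ γ with chain-ends P {X = X} c∈ c≢d γ (supp-base X (type c) v∈) (supp-base X (type d) u∈)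
    ... | (z , refl) , (f , refl) = noChain P c∈ z f eq γ
      where
      w≡ = imageVector-horizontal (σ X) (σ-images X) (Path.starts path) (Path.ends path) im
      eq : abscissa (vec d) ≡ abscissa (vec c) ℤ.+ + X
      eq = trans (sym (ℤ.+-identityʳ _)) (abscissa-shift (vec c) (vec d) 𝟎 w≡ v≡)
    nonOverlapping X noChain P _ {c} {d} {w = w} c∈ d∈ c≢d (path , all) im (v∈ , v∈')
      | u , u∈ , v≡ | _ , inj₂ γ
      with chain-ends P {X = X} d∈ (c≢d ∘ sym) γ (supp-base X (type d) u∈) (supp-base X (type c) v∈)
    ... | (z , refl) , (f , refl) = noChain P d∈ z f eq γ
      where
      w≡ = imageVector-horizontal (σ X) (σ-images X) (Path.starts path) (Path.ends path) im
      eq : abscissa (vec c) ≡ abscissa (vec d) ℤ.+ + X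
      eq = trans (sym (ℤ.+-identityʳ _)) (sym (abscissa-shift (vec c) (vec d) ⟪ + X , 0ℤ ⟫ w≡ v≡))

  -- Positions of tiles and situations of the head.

  cellAt : ℤ → ℤ → Tile → Cell 2 size
  cellAt x y t@(s , a , k) = ⟦ ⟪ x , y ℤ.+ + height s a k ⟫ , code t ⟧

  cellAt-inner : ∀ x y s a k → vec (cellAt x y (s , a , suc k)) ≡
    vec (cellAt x y (s , a , inject₁ k)) ⊕ shift (s , a , suc k)
  cellAt-inner x y s a k = ⟪⟫-cong (sym (ℤ.+-identityʳ x))
    (lemma y (+ height s a (inject₁ k)) (+ height s a (suc k)))
    where
    lemma : ∀ y h h' → y ℤ.+ h' ≡ (y ℤ.+ h) ℤ.+ (h' ℤ.- h)
    lemma = solve-∀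

  cellAt-outer : ∀ x y s a s' a' →
    vec (cellAt (x ℤ.+ dx (move s')) (y ℤ.+ dy (move s')) (s' , a' , zero)) ≡
    vec (cellAt x y (s , a , finish)) ⊕ shift (s' , a' , zero)
  cellAt-outer x y s a s' a' = ⟪⟫-cong refl (trans
    (cong (λ h → (y ℤ.+ dy (move s')) ℤ.+ + h)
      (trans (ℕ.+-suc H (L + L)) (cong suc (sym (height-finish s a)))))
    (lemma y (dy (move s')) (+ height s a finish)))
    where
    lemma : ∀ y d h → (y ℤ.+ d) ℤ.+ (1ℤ ℤ.+ h) ≡ (y ℤ.+ h) ℤ.+ (d ℤ.+ 1ℤ)
    lemma = solve-∀

  -- A situation records the column of the right end of the tape, the state,
  -- the letters to the left of the head (nearest first), the letter under the
  -- head unless its column is fresh, and the letters to its right.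

  data Situation : Set where
    leftward rightward : ℤ → S → List A → Maybe A → List A → Situation

  end : Situation → ℤ
  end (leftward  E _ _ _ _) = E
  end (rightward E _ _ _ _) = E

  state : Situation → S
  state (leftward  _ s _ _ _) = s
  state (rightward _ s _ _ _) = s

  lefts rights : Situation → List A
  lefts (leftward  _ _ ls _ _) = ls
  lefts (rightward _ _ ls _ _) = ls
  rights (leftward  _ _ _ _ rs) = rs
  rights (rightward _ _ _ _ rs) = rs

  under : Situation → Maybe A
  under (leftward  _ _ _ c _) = c
  under (rightward _ _ _ c _) = c

  depth : Situation → ℕ
  depth C = length (rights C)

  -- In a fresh column nothing has been written, so every letter may be guessed.
  data Readable (a : A) : Maybe A → Set where
    known : Readable a (just a)
    fresh : Readable a nothing

  infix 4 _↝⟨_⟩_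

  -- At the end of a row the head opens a new column or turns; after a turn it finds the letter that
  -- it has just written.
  data _↝⟨_⟩_ : Situation → A → Situation → Set where
    go-right   : ∀ {E s ls c d rs a s'} → next s a ≡ just s' → move s' ≡ rightwards →
                 rightward E s ls c (d ∷ rs) ↝⟨ a ⟩ rightward E s' (out s a ∷ ls) (just d) rs
    grow-right : ∀ {E s ls c a s'} → next s a ≡ just s' → move s' ≡ rightwards →
                 rightward E s ls c [] ↝⟨ a ⟩ rightward (E ℤ.+ 1ℤ) s' (out s a ∷ ls) nothing []
    turn-right : ∀ {E s ls c a s'} → next s a ≡ just s' → move s' ≡ upwards →
                 rightward E s ls c [] ↝⟨ a ⟩ leftward E s' ls (just (out s a)) []
    go-left    : ∀ {E s ls c d rs a s'} → next s a ≡ just s' → move s' ≡ leftwards →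
                 leftward E s (d ∷ ls) c rs ↝⟨ a ⟩ leftward E s' ls (just d) (out s a ∷ rs)
    grow-left  : ∀ {E s c rs a s'} → next s a ≡ just s' → move s' ≡ leftwards →
                 leftward E s [] c rs ↝⟨ a ⟩ leftward E s' [] nothing (out s a ∷ rs)
    turn-left  : ∀ {E s c rs a s'} → next s a ≡ just s' → move s' ≡ upwards →
                 leftward E s [] c rs ↝⟨ a ⟩ rightward E s' [] (just (out s a)) rs

  ↝-next : ∀ {C a C'} → C ↝⟨ a ⟩ C' → next (state C) a ≡ just (state C')
  ↝-next (go-right   p _) = p
  ↝-next (grow-right p _) = p
  ↝-next (turn-right p _) = p
  ↝-next (go-left    p _) = p
  ↝-next (grow-left  p _) = p
  ↝-next (turn-left  p _) = p

  -- Columns are numbered by their distance from the right end of the tape.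

  column : ℤ → ℕ → ℤ
  column E n = E ℤ.- + n

  column-right : ∀ E n → column E (suc n) ℤ.+ 1ℤ ≡ column E n
  column-right E n = lemma E (+ n)
    where
    lemma : ∀ e n → (e ℤ.- (1ℤ ℤ.+ n)) ℤ.+ 1ℤ ≡ e ℤ.- n
    lemma = solve-∀

  column-left : ∀ E n → column E n ℤ.+ -1ℤ ≡ column E (suc n)
  column-left E n = lemma E (+ n)
    where
    lemma : ∀ e n → (e ℤ.- n) ℤ.+ -1ℤ ≡ e ℤ.- (1ℤ ℤ.+ n)
    lemma = solve-∀

  column-injective : ∀ E {m n} → column E m ≡ column E n → m ≡ n
  column-injective E {m} {n} eq = ℤ.+-injective (trans (sym (lemma E (+ m))) (trans (cong (λ z → E ℤ.- z) eq) (lemma E (+ n))))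
    where
    lemma : ∀ e n → e ℤ.- (e ℤ.- n) ≡ n
    lemma = solve-∀

  column-shift : ∀ E n → column (E ℤ.+ 1ℤ) (suc n) ≡ column E n
  column-shift E n = lemma E (+ n)
    where
    lemma : ∀ e n → (e ℤ.+ 1ℤ) ℤ.- (1ℤ ℤ.+ n) ≡ e ℤ.- n
    lemma = solve-∀

  column-grow : ∀ E → column E 0 ℤ.+ 1ℤ ≡ column (E ℤ.+ 1ℤ) 0
  column-grow E = lemma E 0ℤ
    where
    lemma : ∀ e n → (e ℤ.- n) ℤ.+ 1ℤ ≡ (e ℤ.+ 1ℤ) ℤ.- n
    lemma = solve-∀

  -- Rows of letters and their change in a step.

  module Rows (Φ : ℤ → ℤ → A → Set) where

    LeftRow : ℤ → ℕ → ℤ → List A → Set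
    LeftRow E n y []       = ⊤
    LeftRow E n y (a ∷ as) = Φ (column E n) y a × LeftRow E (suc n) y as

    RightRow : ℤ → ℤ → List A → Set
    RightRow E y []       = ⊤
    RightRow E y (a ∷ as) = Φ (column E (length as)) y a × RightRow E y as

    -- Letters behind the head are already rewritten, hence `H` higher than those ahead. The tile
    -- under the head has its base at `y + H`. `Φ` becomes `Written` when a pattern is analysed and
    -- `Free` when one is built.
    Tape : ℤ → Situation → Set
    Tape y C@(leftward  E _ ls _ rs) =
      LeftRow E (suc (length rs)) y ls ×
      (∀ {a} → under C ≡ just a → Φ (column E (length rs)) y a) ×
      RightRow E (y ℤ.+ + H) rs
    Tape y C@(rightward E _ ls _ rs) =
      LeftRow E (suc (length rs)) (y ℤ.+ + H) ls ×
      (∀ {a} → under C ≡ just a → Φ (column E (length rs)) y a) ×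
      RightRow E y rs

    leftRow-shift : ∀ {E n y} ls → LeftRow E n y ls → LeftRow (E ℤ.+ 1ℤ) (suc n) y ls
    leftRow-shift []       _        = tt
    leftRow-shift {E} {n} {y} (a ∷ ls) (p , ps) =
      subst (λ x → Φ x y a) (sym (column-shift E n)) p , leftRow-shift ls ps

  module _ {Φ Ψ : ℤ → ℤ → A → Set} {E : ℤ} (d : ℕ)
    (transfer : ∀ {n y a} → n ≢ d → Φ (column E n) y a → Ψ (column E n) y a) where
    private
      module F = Rows Φ
      module G = Rows Ψ

    leftRow-map : ∀ {n y} ls → d < n → F.LeftRow E n y ls → G.LeftRow E n y ls
    leftRow-map []       d<n _        = tt
    leftRow-map (_ ∷ ls) d<n (p , ps) =
      transfer (λ eq → ℕ.<-irrefl (sym eq) d<n) p , leftRow-map ls (ℕ.m<n⇒m<1+n d<n) ps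

    rightRow-map : ∀ {y} rs → length rs ≤ d → F.RightRow E y rs → G.RightRow E y rs
    rightRow-map []       _   _        = tt
    rightRow-map (_ ∷ rs) r≤d (p , ps) =
      transfer (λ eq → ℕ.<-irrefl eq r≤d) p , rightRow-map rs (ℕ.<⇒≤ r≤d) ps

  tape-under : ∀ {Φ y a} C → under C ≡ just a → Rows.Tape Φ y C →
    Φ (column (end C) (depth C)) y a
  tape-under (leftward  _ _ _ _ _) eq (_ , p , _) = p eq
  tape-under (rightward _ _ _ _ _) eq (_ , p , _) = p eq

  record Moved (Ψ : ℤ → ℤ → A → Set) (x y : ℤ) (C' : Situation) : Set where
    field
      level  : ℤ
      tape   : Rows.Tape Ψ level C'
      across : x ℤ.+ dx (move (state C')) ≡ column (end C') (depth C')
      upward : (y ℤ.+ + H) ℤ.+ dy (move (state C')) ≡ level ℤ.+ + H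

  -- A tile affects only its own column: the other letters are transferred, and the letter written
  -- is supplied. Turning raises the level by `H`.
  ↝-moved : ∀ {Φ Ψ y C a C'} → C ↝⟨ a ⟩ C' →
    (∀ {n y b} → n ≢ depth C → Φ (column (end C) n) y b → Ψ (column (end C) n) y b) →
    Ψ (column (end C) (depth C)) (y ℤ.+ + H) (out (state C) a) →
    Rows.Tape Φ y C → Moved Ψ (column (end C) (depth C)) y C'
  ↝-moved {Φ} {Ψ} {y} {rightward E _ ls _ (d ∷ rs)} (go-right _ m) t w (l , _ , (r , rs')) = record
    { level  = y
    ; tape   = (w , leftRow-map {Φ} {Ψ} _ t ls (ℕ.n<1+n _) l)
             , (λ { refl → t (λ eq → ℕ.<-irrefl eq (ℕ.n<1+n _)) r })
             , rightRow-map {Φ} {Ψ} _ t rs (ℕ.n≤1+n _) rs'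
    ; across = trans (cong (λ m → column E (suc (length rs)) ℤ.+ dx m) m) (column-right E (length rs))
    ; upward = trans (cong (λ m → (y ℤ.+ + H) ℤ.+ dy m) m) (ℤ.+-identityʳ _)
    }
  ↝-moved {Φ} {Ψ} {y} {rightward E _ ls _ []} (grow-right _ m) t w (l , _ , _) = record
    { level  = y
    ; tape   = Rows.leftRow-shift Ψ (_ ∷ ls) (w , leftRow-map {Φ} {Ψ} _ t ls (ℕ.n<1+n _) l) , (λ ()) , tt
    ; across = trans (cong (λ m → column E 0 ℤ.+ dx m) m) (column-grow E)
    ; upward = trans (cong (λ m → (y ℤ.+ + H) ℤ.+ dy m) m) (ℤ.+-identityʳ _)
    }
  ↝-moved {Φ} {Ψ} {y} {rightward E _ ls _ []} (turn-right _ m) t w (l , _ , _) = record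
    { level  = y ℤ.+ + H
    ; tape   = leftRow-map {Φ} {Ψ} _ t ls (ℕ.n<1+n _) l , (λ { refl → w }) , tt
    ; across = trans (cong (λ m → column E 0 ℤ.+ dx m) m) (ℤ.+-identityʳ _)
    ; upward = cong (λ m → (y ℤ.+ + H) ℤ.+ dy m) m
    }
  ↝-moved {Φ} {Ψ} {y} {leftward E _ (_ ∷ ls) _ rs} (go-left _ m) t w ((l , ls') , _ , r) = record
    { level  = y
    ; tape   = leftRow-map {Φ} {Ψ} _ t ls (ℕ.m<n⇒m<1+n (ℕ.n<1+n _)) ls'
             , (λ { refl → t (λ eq → ℕ.<-irrefl (sym eq) (ℕ.n<1+n _)) l })
             , (w , rightRow-map {Φ} {Ψ} _ t rs ℕ.≤-refl r)
    ; across = trans (cong (λ m → column E (length rs) ℤ.+ dx m) m) (column-left E (length rs))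
    ; upward = trans (cong (λ m → (y ℤ.+ + H) ℤ.+ dy m) m) (ℤ.+-identityʳ _)
    }
  ↝-moved {Φ} {Ψ} {y} {leftward E _ [] _ rs} (grow-left _ m) t w (_ , _ , r) = record
    { level  = y
    ; tape   = tt , (λ ()) , (w , rightRow-map {Φ} {Ψ} _ t rs ℕ.≤-refl r)
    ; across = trans (cong (λ m → column E (length rs) ℤ.+ dx m) m) (column-left E (length rs))
    ; upward = trans (cong (λ m → (y ℤ.+ + H) ℤ.+ dy m) m) (ℤ.+-identityʳ _)
    }
  ↝-moved {Φ} {Ψ} {y} {leftward E _ [] _ rs} (turn-left _ m) t w (_ , _ , r) = record
    { level  = y ℤ.+ + H
    ; tape   = tt , (λ { refl → w }) , rightRow-map {Φ} {Ψ} _ t rs ℕ.≤-refl r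
    ; across = trans (cong (λ m → column E (length rs) ℤ.+ dx m) m) (ℤ.+-identityʳ _)
    ; upward = cong (λ m → (y ℤ.+ + H) ℤ.+ dy m) m
    }

  -- Soundness: a chain to a final cell follows the computation.

  cell-≡ : ∀ {c d : Cell 2 size} → vec c ≡ vec d → type c ≡ type d → c ≡ d
  cell-≡ refl refl = refl

  inner-successor : ∀ {t t' s a k} → t ⊳ t' → t ≡ (s , a , inject₁ k) → t' ≡ (s , a , suc k)
  inner-successor (inner k) eq with cong proj₁ eq | cong (proj₁ ∘ proj₂) eq
  ... | refl | refl = cong (λ k → _ , _ , Fin.suc k) (inject₁-injective (cong (proj₂ ∘ proj₂) eq))
  inner-successor (outer _ _) eq = ⊥-elim (fromℕ≢inject₁ (cong (proj₂ ∘ proj₂) eq))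

  outer-successor : ∀ {t t' s a} → t ⊳ t' → t ≡ (s , a , finish) →
    ∃[ s' ] ∃[ a' ] (next s a ≡ just s' × t' ≡ (s' , a' , zero))
  outer-successor (inner k)    eq   = ⊥-elim (fromℕ≢inject₁ (sym (cong (proj₂ ∘ proj₂) eq)))
  outer-successor (outer a' p) refl = _ , a' , p , refl

  isFinal⁻ : ∀ s a k → isFinal (s , a , k) ≡ true → accepting s ≡ true × k ≡ finish
  isFinal⁻ s a k f with accepting s
  ... | true with k Fin.≟ finish
  ...   | yes eq = refl , eq

  module Soundness (next≢start : ∀ s a → next s a ≢ just start)
    (accepting-stuck : ∀ s a → accepting s ≡ true → next s a ≡ nothing)
    (P : Pattern 2 size) {e : Cell 2 size} (final : isFinal (decode (type e)) ≡ true) where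
    open Linear next≢start accepting-stuck

    Placed : ℤ → ℤ → S → A → Set
    Placed x y s a = ∀ k → cellAt x y (s , a , k) ∈ cells P

    Written : ℤ → ℤ → A → Set
    Written x y b = ∃[ s ] ∃[ a ] (Placed x y s a × out s a ≡ b)

    -- `n` counts the steps left to `e` and is the measure of the later recursions.
    record Entered (n : ℕ) (s : S) (a : A) (x y : ℤ) : Set where
      constructor entering
      field
        entry  : cellAt x y (s , a , zero) ∈ cells P
        onward : Chain P e n (cellAt x y (s , a , zero))

    isFinal-decode : ∀ t → type e ≡ code t → isFinal t ≡ true
    isFinal-decode t eq = trans (sym (cong isFinal (trans (cong decode eq) (decode-code t)))) final

    -- The chain ends in a final cell, which is the last of its tile; so it cannot end inside a
    -- tile.
    tile-placed : ∀ {n s a x y} → Entered n s a x y → ∀ k →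
      cellAt x y (s , a , k) ∈ cells P ×
      ∃[ m ] (m ≤ n × Chain P e m (cellAt x y (s , a , k)))
    tile-placed {n} {s} {a} {x} {y} (entering c∈ γ) = <-weakInduction _ (c∈ , _ , ℕ.≤-refl , γ) advance
      where
      advance : ∀ k →
        cellAt x y (s , a , inject₁ k) ∈ cells P ×
          ∃[ m ] (m ≤ n × Chain P e m (cellAt x y (s , a , inject₁ k))) →
        cellAt x y (s , a , suc k) ∈ cells P ×
          ∃[ m ] (m ≤ n × Chain P e m (cellAt x y (s , a , suc k)))
      advance k (_ , _ , _ , []) =
        ⊥-elim (fromℕ≢inject₁ (sym (proj₂ (isFinal⁻ s a (inject₁ k) (isFinal-decode (s , a , inject₁ k) refl)))))
      advance k (_ , suc m , m<n , (step p i j v , d∈) ∷ γ)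
        with inner-successor p (sym (code-injective i))
      ... | refl with refl ← cell-≡ {c = cellAt x y (s , a , suc k)} (trans (cellAt-inner x y s a k) (sym v)) (sym j) =
        d∈ , m , ℕ.<⇒≤ m<n , γ

    tile-left : ∀ {n s a x y} → Entered n s a x y →
      (accepting s ≡ true × e ≡ cellAt x y (s , a , finish)) ⊎
      ∃[ s' ] ∃[ a' ] ∃[ m ] (next s a ≡ just s' × m < n ×
        Entered m s' a' (x ℤ.+ dx (move s')) (y ℤ.+ dy (move s')))
    tile-left {s = s} {a} {x} {y} entered with tile-placed entered finish
    ... | _ , _ , _ , [] = inj₁ (proj₁ (isFinal⁻ s a finish (isFinal-decode (s , a , finish) refl)) , refl)
    ... | _ , _ , m≤n , (step p i j v , d∈) ∷ γ
      with s' , a' , n≡ , refl ← outer-successor p (sym (code-injective i))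
      with refl ← cell-≡ {c = cellAt (x ℤ.+ dx (move s')) (y ℤ.+ dy (move s')) (s' , a' , zero)}
             (trans (cellAt-outer x y s a s' a') (sym v)) (sym j) =
      inj₂ (s' , a' , _ , n≡ , m≤n , entering d∈ γ)

    -- If a were not b, the writing tile would have a cell at the position of a.

    read : ∀ {n s a x y b} → Written x y b → Entered n s a x (y ℤ.+ + H) → a ≡ b
    read {s = s} {a} {x} {y} (s₁ , a₁ , placed , refl) entered with index a ℕ.≟ index (out s₁ a₁)
    ... | yes eq = index-injective eq
    ... | no neq = case code-injective (cong type (singleValued P (placed (suc (suc j)))
        (proj₁ (tile-placed entered (suc zero))) (⟪⟫-cong refl same))) of λ ()
      where
      j : Fin (suc L)
      j = inject₁ (Inverse.from A↔ a)

      j≡ : toℕ j ≡ index a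
      j≡ = toℕ-inject₁ _

      same : y ℤ.+ + height s₁ a₁ (suc (suc j)) ≡ (y ℤ.+ + H) ℤ.+ + height s a (suc zero)
      same = trans
        (cong (λ h → y ℤ.+ + (H + h)) (trans (cong (λ i → bump i (out s₁ a₁) + (i + i)) j≡)
          (cong (ℕ._+ (index a + index a)) (bump-other (out s₁ a₁) neq))))
        (sym (ℤ.+-assoc y (+ H) (+ (index a + index a))))

    Present : ℕ → Situation → Set
    Present n C = ∃[ y ] ∃[ a ] (Rows.Tape Written y C ×
      Entered n (state C) a (column (end C) (depth C)) (y ℤ.+ + H))

    readable : ∀ {n a y} C → Rows.Tape Written y C →
      Entered n (state C) a (column (end C) (depth C)) (y ℤ.+ + H) → Readable a (under C)
    readable {a = a} {y} C tape entered with under C in eq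
    ... | nothing = fresh
    ... | just b  = subst (λ b → Readable a (just b))
      (read {y = y} (tape-under {Written} C eq tape) entered) known

    -- The tile is not the last one, as accepting states have no next state. The letter comes from
    -- the pattern, so the hypothesis has to cover every readable one.
    present-step : ∀ {n C} {C' : A → Situation} →
      (∀ {a} → Readable a (under C) → C ↝⟨ a ⟩ C' a) → Present n C →
      ∃[ a ] ∃[ m ] (Readable a (under C) × m < n × Present m (C' a))
    present-step {C = C} {C'} steps (y , a , tape , entered)
      with r ← readable C tape entered
      with tile-left entered
    ... | inj₁ (accepts , _) with () ← trans (sym (↝-next (steps r))) (accepting-stuck (state C) a accepts)
    ... | inj₂ (s' , a' , m , n≡ , m<n , entered') with refl ← trans (sym n≡) (↝-next (steps r)) =
      a , m , r , m<n , level , a' , Moved.tape moved , subst₂ (Entered m s' a') across upward entered'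
      where
      moved : Moved Written (column (end C) (depth C)) y (C' a)
      moved = ↝-moved {Written} (steps r) (λ _ w → w)
        (_ , _ , (λ k → proj₁ (tile-placed entered k)) , refl) tape
      open Moved moved

    present-stuck : ∀ {n C} → (∀ a → next (state C) a ≡ nothing) → Present n C →
      accepting (state C) ≡ true × abscissa (vec e) ≡ column (end C) (depth C)
    present-stuck stuck (y , a , _ , entered) with tile-left entered
    ... | inj₁ (accepts , refl) = accepts , refl
    ... | inj₂ (_ , _ , _ , n≡ , _) with () ← trans (sym n≡) (stuck a)

  -- Walks, and overlap from a connected pattern.

  Edge : List (Cell 2 size) → Cell 2 size → Cell 2 size → Set
  Edge γ c d = (c ∈ γ × d ∈ γ) × (c ⟶ d ⊎ d ⟶ c)

  edge-sym : ∀ {γ c d} → Edge γ c d → Edge γ d c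
  edge-sym ((c∈ , d∈) , inj₁ p) = (d∈ , c∈) , inj₂ p
  edge-sym ((c∈ , d∈) , inj₂ p) = (d∈ , c∈) , inj₁ p

  module _ (X : ℕ) where

    edge-neighbours : ∀ {γ c d} → Edge γ c d → Neighbours (σ X) c d
    edge-neighbours (_ , inj₁ p) = proj₁ (⟶-neighbours {X} p)
    edge-neighbours (_ , inj₂ p) = proj₂ (⟶-neighbours {X} p)

    edge-ruleImage : ∀ {γ c d} → Edge γ c d → ∃ (RuleImage (σ X) c d)
    edge-ruleImage (_ , inj₁ p) = proj₁ (⟶-ruleImage p)
    edge-ruleImage (_ , inj₂ p) = proj₂ (⟶-ruleImage p)

    steps : ∀ {γ c d} → Star (Edge γ) c d → List (Cell 2 size)
    steps ε               = []
    steps (_◅_ {j = d} _ w) = d ∷ steps w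

    steps-linked : ∀ {γ c d} (w : Star (Edge γ) c d) → Linked (Neighbours (σ X)) (c ∷ steps w)
    steps-linked ε       = [-]
    steps-linked (e ◅ w) = edge-neighbours e ∷ steps-linked w

    steps-last : ∀ {γ c d} (w : Star (Edge γ) c d) → last (c ∷ steps w) ≡ just d
    steps-last ε       = refl
    steps-last (e ◅ w) = steps-last w

    steps-∈ : ∀ {γ c d} → c ∈ γ → (w : Star (Edge γ) c d) → All (_∈ γ) (c ∷ steps w)
    steps-∈ c∈ ε                      = c∈ ∷ []
    steps-∈ c∈ (((_ , d∈) , _) ◅ w) = c∈ ∷ steps-∈ d∈ w

    steps-image : ∀ {γ c d} (w : Star (Edge γ) c d) → ∃ (ImageVector (σ X) (c ∷ steps w))
    steps-image ε       = _ , single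
    steps-image (e ◅ w) = _ , step (proj₂ (edge-ruleImage e)) (proj₂ (steps-image w))

    walk-path : ∀ (P : Pattern 2 size) {c d} → c ∈ cells P → (w : Star (Edge (cells P)) c d) →
      PathOf (σ X) P c d (c ∷ steps w)
    walk-path P c∈ w = record
      { starts       = refl
      ; ends         = steps-last w
      ; linked       = steps-linked w
      ; singleValued = λ x∈ y∈ → singleValued P (All.lookup (steps-∈ c∈ w) x∈) (All.lookup (steps-∈ c∈ w) y∈)
      } , steps-∈ c∈ w

  record Rooted (root : Cell 2 size) (γ : List (Cell 2 size)) : Set where
    field
      unambiguous : SingleValued γ
      root∈       : root ∈ γ
      connected   : ∀ {c} → c ∈ γ → Star (Edge γ) root c

  overlapping : ∀ X {root γ d} → Rooted root γ → type root ≡ zero → d ∈ γ →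
    isFinal (decode (type d)) ≡ true → abscissa (vec d) ≡ abscissa (vec root) ℤ.+ + X →
    Overlapping (σ X)
  overlapping X {root} {γ} {d} rooted z d∈ f x≡ nonOverlapping =
    nonOverlapping P covered root∈ d∈ root≢d path vector (v∈ , v∈')
    where
    open Rooted rooted
    P : Pattern 2 size
    P = record { cells = γ ; singleValued = unambiguous }

    covered : Covered (σ X) P
    -- Any two cells are joined through the root.
    covered c∈ c'∈ = _ , walk-path X P c∈ (Star.reverse edge-sym (connected c∈) ◅◅ connected c'∈)

    walk = connected d∈
    path = walk-path X P root∈ walk
    vector = proj₂ (steps-image X walk)
    v = ⟪ + X , 0ℤ ⟫
    w = proj₁ (steps-image X walk)

    -- Type zero has phase 0, a final type the last phase.
    nonzero : ∀ {i} → isFinal (decode i) ≡ true → i ≢ zero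
    nonzero f refl with accepting start
    nonzero () refl | true
    nonzero () refl | false

    root≢d : root ≢ d
    root≢d refl = nonzero f z

    v∈ : v ∈ supp (cells (basePattern X (type root)))
    v∈ rewrite z = here refl

    w≡ : w ≡ v
    w≡ = trans (imageVector-horizontal (σ X) (σ-images X) refl (steps-last X walk) vector)
      (aux (vec root) (vec d) x≡)
      where
      aux : ∀ p q → abscissa q ≡ abscissa p ℤ.+ + X → horizontal (q ⊖ p) ≡ v
      aux ⟪ a , _ ⟫ ⟪ _ , _ ⟫ refl = ⟪⟫-cong (lemma a (+ X)) refl
        where
        lemma : ∀ a x → (a ℤ.+ x) ℤ.- a ≡ x
        lemma = solve-∀

    final-site : ∀ i → i ≢ zero → isFinal (decode i) ≡ true → basePattern X i ≡ site 0 zero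
    final-site zero    i≢ _ = contradiction refl i≢
    final-site (suc i) _  f = cong (if_then site 0 zero else empty) f

    v∈' : v ∈ supp (translate w (cells (basePattern X (type d))))
    v∈' rewrite final-site (type d) (nonzero f) f = here (trans (sym w≡) (sym (⊕-identityʳ w)))

  -- Completeness: building a pattern tile by tile.

  Clear : List (Cell 2 size) → ℤ → ℤ → A → Set
  Clear γ x y a = ∀ {c} → c ∈ γ → abscissa (vec c) ≡ x →
    ordinate (vec c) ℤ.< y ℤ.+ + H × ordinate (vec c) ≢ y ℤ.+ + (index a + index a)

  Free : List (Cell 2 size) → ℤ → ℤ → A → Set
  Free γ x y a = Clear γ x (y ℤ.+ + H) a

  tileCells : ℤ → ℤ → S → A → List (Cell 2 size)
  tileCells x y s a = map (λ k → cellAt x y (s , a , k)) (allFin _)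

  height<2H : ∀ s a k → height s a k < H + H
  height<2H s a zero          = ℕ.+-monoʳ-< H (ℕ.n<1+n _)
  height<2H s a (suc zero)    = ℕ.<-≤-trans (read<H a) (ℕ.m≤m+n H H)
  height<2H s a (suc (suc j)) = ℕ.≤-<-trans (write-height s a j) (ℕ.+-monoʳ-< H (s≤s (ℕ.n≤1+n _)))

  gap : ∀ s a k → height s a k ≢ H + (index (out s a) + index (out s a))
  gap s a zero eq = ℕ.<-irrefl (sym (ℕ.+-cancelˡ-≡ H _ _ eq))
    (s≤s (double≤ (ℕ.<⇒≤ (index<L (out s a)))))
  gap s a (suc zero) eq = ℕ.<-irrefl eq (ℕ.<-≤-trans (read<H a) (ℕ.m≤m+n H _))
  -- Halving gives `toℕ j ≡ i`; but there `bump` is 1, and the cell lies one too high.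
  gap s a (suc (suc j)) eq = ℕ.1+n≢n (trans (cong (ℕ._+ (i + i)) (sym (bump-self b)))
    (subst (λ j → bump j b + (j + j) ≡ i + i) (double-injective (toℕ j) i (bump≤1 (toℕ j) b) z≤n eq') eq'))
    where
    b = out s a
    i = index b

    eq' : bump (toℕ j) b + (toℕ j + toℕ j) ≡ i + i
    eq' = ℕ.+-cancelˡ-≡ H _ _ eq

  -- Old cells stay below the row that is written; the tile stays below the row after it and omits
  -- the position of its letter.
  tile-free : ∀ {γ x y s a} → Clear γ x y a → Free (tileCells x y s a ++ γ) x y (out s a)
  tile-free {γ} {x} {y} {s} {a} clear c∈ x≡ with ∈-++⁻ (tileCells x y s a) c∈
  ... | inj₂ c∈γ =
    ℤ.<-≤-trans (proj₁ (clear c∈γ x≡)) (ℤ.i≤i+j (y ℤ.+ + H) (+ H)) ,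
    λ eq → ℤ.<-irrefl eq (ℤ.<-≤-trans (proj₁ (clear c∈γ x≡)) (ℤ.i≤i+j (y ℤ.+ + H) _))
  ... | inj₁ c∈t with ∈-map⁻ (λ k → cellAt x y (s , a , k)) c∈t
  ...   | k , _ , refl =
    subst (y ℤ.+ + height s a k ℤ.<_) (sym (ℤ.+-assoc y (+ H) (+ H))) (ℤ.+-monoʳ-< y (ℤ.+<+ (height<2H s a k))) ,
    λ eq → gap s a k (ℤ.+-injective (∙-cancelˡ y _ _ (trans eq (ℤ.+-assoc y (+ H) _))))

  ∈-tileCells⁻ : ∀ {γ} x y s a {c} → c ∈ tileCells x y s a ++ γ →
    (∃[ k ] c ≡ cellAt x y (s , a , k)) ⊎ c ∈ γ
  ∈-tileCells⁻ x y s a c∈ with ∈-++⁻ (tileCells x y s a) c∈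
  ... | inj₂ c∈γ = inj₂ c∈γ
  ... | inj₁ c∈t with ∈-map⁻ (λ k → cellAt x y (s , a , k)) c∈t
  ...   | k , _ , eq = inj₁ (k , eq)

  ∈-tileCells⁺ : ∀ {γ} x y s a k → cellAt x y (s , a , k) ∈ tileCells x y s a ++ γ
  ∈-tileCells⁺ x y s a k = ∈-++⁺ˡ (∈-map⁺ (λ k → cellAt x y (s , a , k)) (∈-allFin k))

  elsewhere-free : ∀ {γ x x' y y' s a b} → x' ≢ x →
    Free γ x' y' b → Free (tileCells x y s a ++ γ) x' y' b
  elsewhere-free {x = x} {y = y} {s = s} {a} x'≢x free c∈ x≡ with ∈-tileCells⁻ x y s a c∈
  ... | inj₁ (_ , refl) = contradiction (sym x≡) x'≢x
  ... | inj₂ c∈γ        = free c∈γ x≡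

  -- Only the reading cell lies below `H`, at a position that `Clear` keeps empty; the others lie
  -- above all cells of the column.
  clear-tile : ∀ {γ} x y s a → Clear γ x y a → ∀ {c} k → c ∈ γ → vec c ≢ vec (cellAt x y (s , a , k))
  clear-tile x y s a clear (suc zero) c∈ eq =
    proj₂ (clear c∈ (cong abscissa eq)) (cong ordinate eq)
  clear-tile x y s a clear zero c∈ eq = ℤ.<-irrefl (cong ordinate eq)
    (ℤ.<-≤-trans (proj₁ (clear c∈ (cong abscissa eq))) (ℤ.+-monoʳ-≤ y (ℤ.+≤+ (ℕ.m≤m+n H _))))
  clear-tile x y s a clear (suc (suc _)) c∈ eq = ℤ.<-irrefl (cong ordinate eq)
    (ℤ.<-≤-trans (proj₁ (clear c∈ (cong abscissa eq))) (ℤ.+-monoʳ-≤ y (ℤ.+≤+ (ℕ.m≤m+n H _))))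

  cellAt-injective : ∀ {x y s a k k'} →
    vec (cellAt x y (s , a , k)) ≡ vec (cellAt x y (s , a , k')) → k ≡ k'
  cellAt-injective {y = y} {s} {a} eq =
    height-injective s a (ℤ.+-injective (∙-cancelˡ y _ _ (cong ordinate eq)))

  place-unambiguous : ∀ {γ} x y s a → SingleValued γ → Clear γ x y a →
    SingleValued (tileCells x y s a ++ γ)
  place-unambiguous x y s a sv clear c∈ d∈ eq with ∈-tileCells⁻ x y s a c∈ | ∈-tileCells⁻ x y s a d∈
  ... | inj₁ (k , refl) | inj₁ (k' , refl) = cong (λ k → cellAt x y (s , a , k)) (cellAt-injective {y = y} {s} {a} {k} {k'} eq)
  ... | inj₁ (k , refl) | inj₂ d∈γ         = contradiction (sym eq) (clear-tile x y s a clear k d∈γ)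
  ... | inj₂ c∈γ        | inj₁ (k , refl)  = contradiction eq (clear-tile x y s a clear k c∈γ)
  ... | inj₂ c∈γ        | inj₂ d∈γ         = sv c∈γ d∈γ eq

  place-connected : ∀ {γ} x y s a {root} → let γ' = tileCells x y s a ++ γ in
    Star (Edge γ') root (cellAt x y (s , a , zero)) → ∀ k →
    Star (Edge γ') root (cellAt x y (s , a , k))
  place-connected x y s a w = <-weakInduction _ w
    λ k w → w ◅◅ ((∈-tileCells⁺ x y s a (inject₁ k) , ∈-tileCells⁺ x y s a (suc k)) ,
                 inj₁ (step (inner k) refl refl (cellAt-inner x y s a k))) ◅ ε

  -- The last cell of a tile to which a tile in state `s'` can be attached; the letter of the latter
  -- is still open.
  Pending : List (Cell 2 size) → S → ℤ → ℤ → Set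
  Pending γ s' x' y' = ∃[ s ] ∃[ a ] ∃[ x ] ∃[ y ] (cellAt x y (s , a , finish) ∈ γ ×
    next s a ≡ just s' × x ℤ.+ dx (move s') ≡ x' × y ℤ.+ dy (move s') ≡ y')

  place-rooted : ∀ {γ} x y s a {root} → Rooted root γ → Clear γ x y a → Pending γ s x y →
    Rooted root (tileCells x y s a ++ γ)
  place-rooted {γ} _ _ s a {root} rooted clear (s₀ , a₀ , x₀ , y₀ , c∈ , n≡ , refl , refl) = record
    { unambiguous = place-unambiguous _ (y₀ ℤ.+ dy (move s)) s a unambiguous clear
    ; root∈       = ∈-++⁺ʳ _ root∈
    ; connected   = λ d∈ → aux (∈-tileCells⁻ _ (y₀ ℤ.+ dy (move s)) s a d∈)
    }
    where
    open Rooted rooted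
    γ' = tileCells (x₀ ℤ.+ dx (move s)) (y₀ ℤ.+ dy (move s)) s a ++ γ

    old : ∀ {c} → c ∈ γ → Star (Edge γ') root c
    old c∈ = Star.map (λ ((u , v) , e) → (∈-++⁺ʳ _ u , ∈-++⁺ʳ _ v) , e) (connected c∈)

    entry : Star (Edge γ') root (cellAt (x₀ ℤ.+ dx (move s)) (y₀ ℤ.+ dy (move s)) (s , a , zero))
    entry = old c∈ ◅◅ ((∈-++⁺ʳ _ c∈ , ∈-tileCells⁺ _ (y₀ ℤ.+ dy (move s)) s a zero) ,
      inj₁ (step (outer a n≡) refl refl (cellAt-outer x₀ y₀ s₀ a₀ s a))) ◅ ε

    aux : ∀ {c} → (∃[ k ] c ≡ cellAt (x₀ ℤ.+ dx (move s)) (y₀ ℤ.+ dy (move s)) (s , a , k)) ⊎ c ∈ γ →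
      Star (Edge γ') root c
    aux (inj₁ (k , refl)) = place-connected _ (y₀ ℤ.+ dy (move s)) s a entry k
    aux (inj₂ c∈)         = old c∈

  first-tile : ∀ x y s a → Rooted (cellAt x y (s , a , zero)) (tileCells x y s a ++ [])
  first-tile x y s a = record
    { unambiguous = place-unambiguous x y s a (λ ()) (λ ())
    ; root∈       = ∈-tileCells⁺ x y s a zero
    ; connected   = λ d∈ → aux (∈-tileCells⁻ x y s a d∈)
    }
    where
    aux : ∀ {c} → (∃[ k ] c ≡ cellAt x y (s , a , k)) ⊎ c ∈ [] →
      Star (Edge (tileCells x y s a ++ [])) (cellAt x y (s , a , zero)) c
    aux (inj₁ (k , refl)) = place-connected x y s a ε k
    aux (inj₂ ())

  -- The columns occupied so far; the column under the head may still be fresh.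

  Occupied : Situation → ℕ → Set
  Occupied C n = n < suc (length (rights C) + length (lefts C)) ×
    (under C ≡ nothing → n ≢ depth C)

  record Built (root : Cell 2 size) (γ : List (Cell 2 size)) (C : Situation) : Set where
    field
      rooted  : Rooted root γ
      level   : ℤ
      tape    : Rows.Tape (Free γ) level C
      extent  : ∀ {c} → c ∈ γ → ∃[ n ] (Occupied C n × abscissa (vec c) ≡ column (end C) n)
      pending : Pending γ (state C) (column (end C) (depth C)) (level ℤ.+ + H)

  private
    below : ∀ {n d e e'} {B : Set} → (n < e × B) ⊎ n ≡ d → e ≤ e' → d < e' → n < e'
    below (inj₁ (n<e , _)) e≤e' _    = ℕ.<-≤-trans n<e e≤e'
    below (inj₂ refl)      _    d<e' = d<e'

  occupied-step : ∀ {C a C' n} → C ↝⟨ a ⟩ C' → Occupied C n ⊎ n ≡ depth C →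
    ∃[ n' ] (Occupied C' n' × column (end C) n ≡ column (end C') n')
  occupied-step {rightward _ _ ls _ (_ ∷ rs)} (go-right _ _) o =
    _ , (below o (s≤s (ℕ.≤-reflexive (sym (ℕ.+-suc (length rs) (length ls)))))
                 (s≤s (subst (suc (length rs) ≤_) (sym (ℕ.+-suc (length rs) _)) (s≤s (ℕ.m≤m+n _ _)))) ,
         λ ()) , refl
  occupied-step {rightward E _ ls _ []} {n = n} (grow-right _ _) o =
    suc n , (s≤s (below o ℕ.≤-refl (s≤s z≤n)) , λ _ ()) , sym (column-shift E n)
  occupied-step {rightward _ _ ls _ []} (turn-right _ _) o =
    _ , (below o ℕ.≤-refl (s≤s z≤n) , λ ()) , refl
  occupied-step {leftward _ _ (_ ∷ ls) _ rs} (go-left _ _) o =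
    _ , (below o (s≤s (ℕ.≤-reflexive (ℕ.+-suc (length rs) (length ls))))
                 (s≤s (ℕ.m≤n⇒m≤1+n (ℕ.m≤m+n _ _))) ,
         λ ()) , refl
  occupied-step {leftward _ _ [] _ rs} {n = n} (grow-left _ _) o =
    _ , (ℕ.m<n⇒m<1+n n< , λ _ eq → ℕ.<-irrefl eq (subst (n <_) (cong suc (ℕ.+-identityʳ (length rs))) n<)) , refl
    where
    n< = below o ℕ.≤-refl (s≤s (ℕ.m≤m+n (length rs) 0))
  occupied-step {leftward _ _ [] _ rs} (turn-left _ _) o =
    _ , (below o ℕ.≤-refl (s≤s (ℕ.m≤m+n _ _)) , λ ()) , refl

  -- For a known letter this is part of the tape; a fresh column contains no cell at all, by
  -- `extent`.
  built-clear : ∀ {root γ C a} (b : Built root γ C) → Readable a (under C) →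
    Clear γ (column (end C) (depth C)) (Built.level b ℤ.+ + H) a
  built-clear {γ = γ} {C} {a} b r {c} c∈ x≡ with under C in eq | r
  ... | just _  | known = tape-under {Free γ} C eq (Built.tape b) c∈ x≡
  ... | nothing | fresh with Built.extent b c∈
  ...   | n , (_ , n≢) , x≡' = ⊥-elim (n≢ eq (column-injective (end C) (trans (sym x≡') x≡)))

  built-step : ∀ {root γ C a C'} → C ↝⟨ a ⟩ C' → Readable a (under C) → Built root γ C →
    ∃[ γ' ] Built root γ' C'
  built-step {γ = γ} {C} {a} {C'} p r b = γ' , record
    { rooted  = place-rooted _ (level ℤ.+ + H) (state C) a rooted clear pending
    ; level   = Moved.level moved
    ; tape    = Moved.tape moved
    ; extent  = λ c∈ → aux (∈-tileCells⁻ _ (level ℤ.+ + H) (state C) a c∈)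
    ; pending = state C , a , column (end C) (depth C) , level ℤ.+ + H ,
        ∈-tileCells⁺ _ (level ℤ.+ + H) (state C) a finish ,
        ↝-next p , Moved.across moved , Moved.upward moved
    }
    where
    open Built b
    clear : Clear γ (column (end C) (depth C)) (level ℤ.+ + H) a
    clear = built-clear b r
    γ' = tileCells (column (end C) (depth C)) (level ℤ.+ + H) (state C) a ++ γ

    moved : Moved (Free γ') (column (end C) (depth C)) level C'
    moved = ↝-moved {Free γ} {Free γ'} p
      (λ {n} {y} n≢ → elsewhere-free {y = level ℤ.+ + H} {y' = y} (n≢ ∘ column-injective (end C)))
      (tile-free {y = level ℤ.+ + H} clear) tape

    aux : ∀ {c} → (∃[ k ] c ≡ cellAt (column (end C) (depth C)) (level ℤ.+ + H) (state C , a , k)) ⊎ c ∈ γ →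
      ∃[ n ] (Occupied C' n × abscissa (vec c) ≡ column (end C') n)
    aux (inj₁ (k , refl)) = occupied-step p (inj₂ refl)
    aux (inj₂ c∈) with extent c∈
    ... | n , o , x≡ with occupied-step p (inj₁ o)
    ...   | n' , o' , eq = n' , o' , trans x≡ eq

  built-accepting : ∀ {root γ C a} → Readable a (under C) → accepting (state C) ≡ true →
    Built root γ C → ∃[ γ' ] ∃[ d ] (Rooted root γ' × d ∈ γ' × isFinal (decode (type d)) ≡ true ×
      abscissa (vec d) ≡ column (end C) (depth C))
  built-accepting {C = C} {a} r accepts b =
    _ , cellAt _ (level ℤ.+ + H) (state C , a , finish) ,
    place-rooted _ (level ℤ.+ + H) (state C) a rooted (built-clear b r) pending ,
    ∈-tileCells⁺ _ (level ℤ.+ + H) (state C) a finish ,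
    trans (cong isFinal (decode-code (state C , a , finish)))
      (cong₂ _∧_ accepts (dec-true (finish Fin.≟ finish) refl)) , refl
    where open Built b

  -- The first tile is treated as a step from the empty tape, for which all conditions on cells hold
  -- vacuously.
  built-start : ∀ {s'} E y → next start origin ≡ just s' → move s' ≡ rightwards →
    ∃[ γ ] Built (cellAt (column E 0) (y ℤ.+ + H) (start , origin , zero)) γ
      (rightward (E ℤ.+ 1ℤ) s' (out start origin ∷ []) nothing [])
  built-start {s'} E y n≡ m≡ = γ , record
    { rooted  = first-tile (column E 0) (y ℤ.+ + H) start origin
    ; level   = Moved.level moved
    ; tape    = Moved.tape moved
    ; extent  = λ c∈ → aux (∈-tileCells⁻ (column E 0) (y ℤ.+ + H) start origin c∈)
    ; pending = start , origin , column E 0 , y ℤ.+ + H ,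
        ∈-tileCells⁺ (column E 0) (y ℤ.+ + H) start origin finish ,
        n≡ , Moved.across moved , Moved.upward moved
    }
    where
    γ = tileCells (column E 0) (y ℤ.+ + H) start origin ++ []

    C C' : Situation
    C  = rightward E start [] nothing []
    C' = rightward (E ℤ.+ 1ℤ) s' (out start origin ∷ []) nothing []

    first-step : C ↝⟨ origin ⟩ C'
    first-step = grow-right n≡ m≡

    moved : Moved (Free γ) (column E 0) y C'
    moved = ↝-moved {Free []} {Free γ} first-step
      (λ {n} {y'} n≢ → elsewhere-free {y = y ℤ.+ + H} {y' = y'} (n≢ ∘ column-injective E))
      (tile-free {y = y ℤ.+ + H} (λ ())) (tt , (λ ()) , tt)

    aux : ∀ {c} → (∃[ k ] c ≡ cellAt (column E 0) (y ℤ.+ + H) (start , origin , k)) ⊎ c ∈ [] →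
      ∃[ n ] (Occupied C' n × abscissa (vec c) ≡ column (E ℤ.+ 1ℤ) n)
    aux (inj₁ (k , refl)) = occupied-step first-step (inj₂ refl)
    aux (inj₂ ())

-- The register machine as a zigzagging head.

module Simulation (N : Machine) where
  open Machine N

  Q Register Body Letter State : Set
  Q        = Fin (suc states)
  Register = Fin (suc registers)
  Body     = Fin 1 ⊎ (Register × Bool)
  Letter   = Fin 2 ⊎ Body
  State    = Fin 9 × Q

  -- A row is ⊢ l ⊣ with a list l of bodies: the letters of register i are the
  -- tags (i , b), and blanks are deleted letters.  The states start and init
  -- write the first row, guessing its length.  Afterwards, from turn q at the
  -- right end, back q returns to the left end.  A push inserts its letter there;
  -- a pop is executed by search q on the way to the right.

  pattern ⊢       = inj₁ zero
  pattern ⊣       = inj₁ (suc zero)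
  pattern body β  = inj₂ β
  pattern blank   = inj₁ zero
  pattern tag i b = inj₂ (i , b)

  pattern start q      = zero , q
  pattern init q       = suc zero , q
  pattern turn q       = suc (suc zero) , q
  pattern back q       = suc (suc (suc zero)) , q
  pattern extend q     = suc (suc (suc (suc zero))) , q
  pattern liftCopy q   = suc (suc (suc (suc (suc zero)))) , q
  pattern liftSearch q = suc (suc (suc (suc (suc (suc zero))))) , q
  pattern copy q       = suc (suc (suc (suc (suc (suc (suc zero)))))) , q
  pattern search q     = suc (suc (suc (suc (suc (suc (suc (suc zero))))))) , q

  Code : Set
  Code = Instruction (suc states) (suc registers)

  choose : Bool → Q → Q → Q
  choose false f t = f
  choose true  f t = t

  outLeft : Code → Letter
  outLeft (push i b _)  = body (tag i b)
  outLeft (pop _ _ _ _) = ⊢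
  outLeft (halt _)      = ⊢

  nextLeft : Q → Code → Maybe State
  nextLeft q (push _ _ q')   = just (extend q')
  nextLeft q (pop _ _ _ _)   = just (liftSearch q)
  nextLeft q (halt _)        = nothing

  nextTurn : Q → Code → Maybe State
  nextTurn q (halt _) = nothing
  nextTurn q _        = just (back q)

  outTag : ∀ {P : Set} → Dec P → Register → Bool → Letter
  outTag (yes _) j b = body blank
  outTag (no _)  j b = body (tag j b)

  nextTag : ∀ {P : Set} → Dec P → Q → Q → State
  nextTag (yes _) q q' = copy q'
  nextTag (no _)  q q' = search q

  outSearch : Code → Register → Bool → Letter
  outSearch (pop i _ _ _) j b = outTag (i Fin.≟ j) j b
  outSearch _             j b = body (tag j b)

  nextSearch : Q → Code → Register → Bool → State
  nextSearch q (pop i _ f t) j b = nextTag (i Fin.≟ j) q (choose b f t)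
  nextSearch q _             j b = search q

  nextEmpty : Code → Maybe State
  nextEmpty (pop _ e _ _) = just (turn e)
  nextEmpty _             = nothing

  out : State → Letter → Letter
  out (start _)  _                = ⊢
  out (init _)   ⊣                = ⊣
  out (init _)   _                = body (tag zero true)
  out (back q)   ⊢                = outLeft (program q)
  out (extend _) _                = ⊢
  out (search q) (body (tag j b)) = outSearch (program q) j b
  out _          a                = a

  goto : State → Letter → Maybe State
  goto (start _)      _                = just (init zero)
  goto (init _)       ⊣                = just (turn zero)
  goto (init _)       _                = just (init zero)
  goto (turn q)       _                = nextTurn q (program q)
  goto (back q)       ⊢                = nextLeft q (program q)
  goto (back q)       _                = just (back q)
  goto (extend q)     _                = just (liftCopy q)
  goto (liftCopy q)   _                = just (copy q)
  goto (liftSearch q) _                = just (search q)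
  goto (copy q)       ⊣                = just (turn q)
  goto (copy q)       _                = just (copy q)
  goto (search q)     ⊣                = nextEmpty (program q)
  goto (search q)     (body (tag j b)) = just (nextSearch q (program q) j b)
  goto (search q)     _                = just (search q)

  move : State → Move
  move (init _)   = rightwards
  move (back _)   = leftwards
  move (extend _) = leftwards
  move (copy _)   = rightwards
  move (search _) = rightwards
  move _          = upwards

  rejecting : Code → Bool
  rejecting (halt false) = true
  rejecting _            = false

  -- In the state `turn q` the head is at the right end, whose column records the length of the
  -- input.
  accepting : State → Bool
  accepting (turn q) = rejecting (program q)
  accepting _        = false

  State↔ : Fin (9 ℕ.* suc states) ↔ State
  State↔ = *↔×

  Letter↔ : Fin (2 + (1 + suc registers ℕ.* 2)) ↔ Letter
  Letter↔ = (↔-id _ ⊎-↔ ((↔-id _ ⊎-↔ (↔-id _ ⊗ 2↔Bool)) ↔-∘ +↔⊎)) ↔-∘ +↔⊎ {2}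

  open ZigZag State↔ Letter↔ out goto move accepting hiding (start) public

  goto≢start : ∀ s a → goto s a ≢ just (start zero)
  goto≢start (start _)      _                ()
  goto≢start (init _)       ⊢                ()
  goto≢start (init _)       ⊣                ()
  goto≢start (init _)       (body _)         ()
  goto≢start (turn q)       _                with program q
  ... | push _ _ _  = λ ()
  ... | pop _ _ _ _ = λ ()
  ... | halt _      = λ ()
  goto≢start (back q)       ⊢                with program q
  ... | push _ _ _  = λ ()
  ... | pop _ _ _ _ = λ ()
  ... | halt _      = λ ()
  goto≢start (back q)       ⊣                ()
  goto≢start (back q)       (body _)         ()
  goto≢start (extend q)     _                ()
  goto≢start (liftCopy q)   _                ()
  goto≢start (liftSearch q) _                ()
  goto≢start (copy q)       ⊢                ()
  goto≢start (copy q)       ⊣                ()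
  goto≢start (copy q)       (body _)         ()
  goto≢start (search q)     ⊢                ()
  goto≢start (search q)     ⊣                with program q
  ... | push _ _ _  = λ ()
  ... | pop _ _ _ _ = λ ()
  ... | halt _      = λ ()
  goto≢start (search q)     (body blank)     ()
  goto≢start (search q)     (body (tag j b)) with program q
  ... | push _ _ _  = λ ()
  ... | halt _      = λ ()
  ... | pop i _ f t with i Fin.≟ j
  ...   | yes _ = λ ()
  ...   | no  _ = λ ()

  accepting-stuck : ∀ s a → accepting s ≡ true → goto s a ≡ nothing
  accepting-stuck (turn q) a accepts with program q
  ... | halt false = refl

  -- Quantified over readable letters, a step does not depend on the guess in a fresh column.
  _↝_ : Situation → Situation → Set
  C ↝ C' = ∀ {a} → Readable a (under C) → C ↝⟨ a ⟩ C'

  _↝⁺_ : Situation → Situation → Set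
  _↝⁺_ = TransClosure _↝_

  _↝*_ : Situation → Situation → Set
  C ↝* C' = C ≡ C' ⊎ C ↝⁺ C'

  infixr 5 _▸_
  _▸_ : ∀ {C D E} → C ↝⁺ D → D ↝* E → C ↝⁺ E
  w ▸ inj₁ refl = w
  w ▸ inj₂ w'   = w Plus.++ w'

  -- Registers as tagged sublists of a row.

  contentTag : ∀ {P : Set} → Dec P → Bool → Word → Word
  contentTag (yes _) b w = b ∷ w
  contentTag (no _)  b w = w

  content : Register → List Body → Word
  content i []            = []
  content i (blank ∷ l)   = content i l
  content i (tag j b ∷ l) = contentTag (i Fin.≟ j) b (content i l)

  deleteTag : ∀ {P : Set} → Dec P → Register → Bool → List Body → List Body → List Body
  deleteTag (yes _) j b l l' = blank ∷ l
  deleteTag (no _)  j b l l' = tag j b ∷ l'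

  delete : Register → List Body → List Body
  delete i []            = []
  delete i (blank ∷ l)   = blank ∷ delete i l
  delete i (tag j b ∷ l) = deleteTag (i Fin.≟ j) j b l (delete i l)

  Represents : List Body → Vec.Vec Word (suc registers) → Set
  Represents l R = ∀ i → content i l ≡ Vec.lookup R i

  content-insert : ∀ i b l → content i (tag i b ∷ l) ≡ b ∷ content i l
  content-insert i b l with i Fin.≟ i
  ... | yes _  = refl
  ... | no i≢i = contradiction refl i≢i

  content-insert-other : ∀ {i j} b l → i ≢ j → content i (tag j b ∷ l) ≡ content i l
  content-insert-other {i} {j} b l i≢j with i Fin.≟ j
  ... | yes i≡j = contradiction i≡j i≢j
  ... | no _    = refl

  content-delete : ∀ i l → content i (delete i l) ≡ List.drop 1 (content i l)
  content-delete i []            = refl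
  content-delete i (blank ∷ l)   = content-delete i l
  content-delete i (tag j b ∷ l) with i Fin.≟ j
  ... | yes refl = refl
  ... | no i≢j   = trans (content-insert-other b (delete i l) i≢j) (content-delete i l)

  content-delete-other : ∀ {i j} l → i ≢ j → content i (delete j l) ≡ content i l
  content-delete-other         []            i≢j = refl
  content-delete-other         (blank ∷ l)   i≢j = content-delete-other l i≢j
  content-delete-other {i} {j} (tag k b ∷ l) i≢j with j Fin.≟ k
  ... | yes refl = sym (content-insert-other b l i≢j)
  ... | no _ with i Fin.≟ k
  ...   | yes _ = cong (b ∷_) (content-delete-other l i≢j)
  ...   | no _  = content-delete-other l i≢j

  update : ∀ l l' R i w → Represents l R → content i l' ≡ w →
    (∀ {j} → j ≢ i → content j l' ≡ content j l) → Represents l' (R Vec.[ i ]≔ w)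
  update l l' R i w rep eq eq' j with j Fin.≟ i
  ... | yes refl = trans eq (sym (Vec.lookup∘updateAt i R))
  ... | no j≢i   = trans (eq' j≢i) (trans (rep j) (sym (Vec.lookup∘updateAt′ j i j≢i R)))

  -- Runs of the head along a row.

  arriveL arriveR : ℤ → State → List Letter → List Letter → Situation
  arriveL E s []       rs = leftward E s [] nothing rs
  arriveL E s (d ∷ ls) rs = leftward E s ls (just d) rs
  arriveR E s ls []       = rightward E s ls nothing []
  arriveR E s ls (d ∷ rs) = rightward E s ls (just d) rs

  stepL : ∀ {E s a s' b} ls {rs} → goto s a ≡ just s' → out s a ≡ b → move s' ≡ leftwards →
    leftward E s ls (just a) rs ↝ arriveL E s' ls (b ∷ rs)
  stepL []      p refl m known = grow-left p m
  stepL (_ ∷ _) p refl m known = go-left p m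

  -- The marker `⊣` ahead prevents growth, so the right end stays fixed; the case distinction only
  -- exposes the next letter.
  stepR : ∀ {E s a s' b ls} l → goto s a ≡ just s' → out s a ≡ b → move s' ≡ rightwards →
    rightward E s ls (just a) (map body l ++ [ ⊣ ]) ↝ arriveR E s' (b ∷ ls) (map body l ++ [ ⊣ ])
  stepR []      p refl m known = go-right p m
  stepR (_ ∷ _) p refl m known = go-right p m

  turnR : ∀ {E s a s' b ls} → goto s a ≡ just s' → out s a ≡ b → move s' ≡ upwards →
    rightward E s ls (just a) [] ↝ leftward E s' ls (just b) []
  turnR p refl m known = turn-right p m

  turnL : ∀ {E s a s' b rs} → goto s a ≡ just s' → out s a ≡ b → move s' ≡ upwards →
    leftward E s [] (just a) rs ↝ rightward E s' [] (just b) rs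
  turnL p refl m known = turn-left p m

  Row : ℤ → Q → List Body → Situation
  Row E q l = leftward E (turn q) (map body (reverse l) ++ [ ⊢ ]) (just ⊣) []

  back-run : ∀ {E q} r {rs} → arriveL E (back q) (map body r ++ [ ⊢ ]) rs ↝*
    leftward E (back q) [] (just ⊢) (map body r ʳ++ rs)
  back-run []      = inj₁ refl
  back-run (β ∷ r) = inj₂ (TransClosure.[ stepL (map body r ++ [ ⊢ ]) refl refl refl ] ▸ back-run r)

  copy-run : ∀ {E q} l {ls} → arriveR E (copy q) ls (map body l ++ [ ⊣ ]) ↝⁺
    leftward E (turn q) (map body l ʳ++ ls) (just ⊣) []
  copy-run []      = TransClosure.[ turnR refl refl refl ]
  copy-run (β ∷ l) = stepR l refl refl refl ∷ copy-run l

  popped : Q → Q → Q → Word → Q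
  popped e f t []      = e
  popped e f t (b ∷ _) = choose b f t

  -- Stated for an arbitrary decision, because the state, the letter written, the content and the
  -- deletion all branch on the same one.
  search-tag : ∀ {E q j b f t e w l l'} {P : Set} (d : Dec P) →
    goto (search q) (body (tag j b)) ≡ just (nextTag d q (choose b f t)) →
    out (search q) (body (tag j b)) ≡ outTag d j b →
    (∀ {ls} → arriveR E (search q) ls (map body l ++ [ ⊣ ]) ↝⁺
      leftward E (turn (popped e f t w)) (map body l' ʳ++ ls) (just ⊣) []) →
    ∀ {ls} → arriveR E (search q) ls (map body (tag j b ∷ l) ++ [ ⊣ ]) ↝⁺
      leftward E (turn (popped e f t (contentTag d b w))) (map body (deleteTag d j b l l') ʳ++ ls) (just ⊣) []
  search-tag {l = l} (yes _) p o _   = stepR l p o refl ∷ copy-run l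
  search-tag {l = l} (no _)  p o run = stepR l p o refl ∷ run

  search-run : ∀ {E q i e f t} → program q ≡ pop i e f t → ∀ l {ls} →
    arriveR E (search q) ls (map body l ++ [ ⊣ ]) ↝⁺
    leftward E (turn (popped e f t (content i l))) (map body (delete i l) ʳ++ ls) (just ⊣) []
  search-run p []                   = TransClosure.[ turnR (cong nextEmpty p) refl refl ]
  search-run p (blank ∷ l)          = stepR l refl refl refl ∷ search-run p l
  search-run {q = q} {i} {e} {f} {t} p (tag j b ∷ l) =
    search-tag {q = q} {j} {b} {f} {t} {e} (i Fin.≟ j) (cong (λ c → just (nextSearch q c j b)) p)
      (cong (λ c → outSearch c j b) p) (search-run p l)

  map-reverse-ʳ++ : ∀ l {ys : List Letter} → map body (reverse l) ʳ++ ys ≡ map body l ++ ys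
  map-reverse-ʳ++ l = trans (List.ʳ++-defn (map body (reverse l))) (cong (_++ _)
    (trans (sym (List.reverse-map body (reverse l))) (cong (map body) (List.reverse-involutive l))))

  map-ʳ++-reverse : ∀ l {ys : List Letter} → map body l ʳ++ ys ≡ map body (reverse l) ++ ys
  map-ʳ++-reverse l = trans (List.ʳ++-defn (map body l)) (cong (_++ _) (sym (List.reverse-map body l)))

  return : ∀ {E q} l → goto (turn q) ⊣ ≡ just (back q) →
    Row E q l ↝⁺ leftward E (back q) [] (just ⊢) (map body l ++ [ ⊣ ])
  return {E} {q} l p = subst (λ rs → Row E q l ↝⁺ leftward E (back q) [] (just ⊢) rs) (map-reverse-ʳ++ l)
    (TransClosure.[ stepL (map body (reverse l) ++ [ ⊢ ]) p refl refl ] ▸ back-run (reverse l))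

  push-run : ∀ {E q i b q'} → program q ≡ push i b q' → ∀ l → Row E q l ↝⁺ Row E q' (tag i b ∷ l)
  push-run {E} {q} {i} {b} {q'} p l =
    return l (cong (nextTurn q) p) Plus.++
    (stepL [] (cong (nextLeft q) p) (cong outLeft p) refl ∷
    -- The column of `extend` is fresh: whatever is guessed there, `⊢` is written.
    (λ { fresh → turn-left refl refl }) ∷
    stepR (tag i b ∷ l) refl refl refl ∷
    subst (λ ls → arriveR E (copy q') [ ⊢ ] (map body (tag i b ∷ l) ++ [ ⊣ ]) ↝⁺
        leftward E (turn q') ls (just ⊣) [])
      (map-ʳ++-reverse (tag i b ∷ l)) (copy-run (tag i b ∷ l)))

  pop-run : ∀ {E q i e f t} → program q ≡ pop i e f t → ∀ l →
    Row E q l ↝⁺ Row E (popped e f t (content i l)) (delete i l)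
  pop-run {E} {q} {i} {e} {f} {t} p l =
    return l (cong (nextTurn q) p) Plus.++
    (turnL (cong (nextLeft q) p) (cong outLeft p) refl ∷
    stepR l refl refl refl ∷
    subst (λ ls → arriveR E (search q) [ ⊢ ] (map body l ++ [ ⊣ ]) ↝⁺
        leftward E (turn (popped e f t (content i l))) ls (just ⊣) [])
      (map-ʳ++-reverse (delete i l)) (search-run p l))

  delete-empty : ∀ i l → content i l ≡ [] → ∀ j → content j (delete i l) ≡ content j l
  delete-empty i l c j with j Fin.≟ i
  ... | yes refl = trans (content-delete i l) (trans (cong (List.drop 1) c) (sym c))
  ... | no j≢i   = content-delete-other l j≢i

  pop-represents : ∀ {i e f t R} l → Represents l R → ∀ w → content i l ≡ w →
    Represents (delete i l) (proj₂ (popInto N i e f t w R))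
  pop-represents {i} l rep []          c = λ j → trans (delete-empty i l c j) (rep j)
  pop-represents {i} {R = R} l rep (false ∷ w) c =
    update l (delete i l) R i w rep (trans (content-delete i l) (cong (List.drop 1) c)) (content-delete-other l)
  pop-represents {i} {R = R} l rep (true ∷ w)  c =
    update l (delete i l) R i w rep (trans (content-delete i l) (cong (List.drop 1) c)) (content-delete-other l)

  popped-state : ∀ {i e f t R} w → popped e f t w ≡ proj₁ (popInto N i e f t w R)
  popped-state []          = refl
  popped-state (false ∷ w) = refl
  popped-state (true ∷ w)  = refl

  -- One instruction is one round trip. The new list does not depend on `E`, since the row grows
  -- only to the left.
  machine-step : ∀ {q R κ} l → Represents l R → ∀ c → program q ≡ c → execute N c R ≡ inj₂ κ →
    ∃[ l' ] (Represents l' (proj₂ κ) × (∀ E → Row E q l ↝⁺ Row E (proj₁ κ) l'))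
  machine-step {R = R} l rep (push i b q') p refl =
    tag i b ∷ l ,
    update l (tag i b ∷ l) R i (b ∷ Vec.lookup R i) rep
      (trans (content-insert i b l) (cong (b ∷_) (rep i))) (content-insert-other b l) ,
    λ E → push-run p l
  machine-step {q} {R} l rep (pop i e f t) p refl =
    delete i l , pop-represents l rep (Vec.lookup R i) (rep i) ,
    λ E → subst (λ q' → Row E q l ↝⁺ Row E q' (delete i l))
      (trans (cong (popped e f t) (rep i)) (popped-state (Vec.lookup R i))) (pop-run p l)

  reverse-replicate : ∀ {B : Set} (b : B) n → reverse (replicate n b) ≡ replicate n b
  reverse-replicate b n = trans (aux n []) (List.++-identityʳ _)
    where
    aux : ∀ n ys → replicate n b ʳ++ ys ≡ replicate n b ++ ys
    aux zero    ys = refl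
    aux (suc n) ys = trans (aux n (b ∷ ys)) (replicate-snoc b n ys)

  -- The guessed input.

  units : ℕ → List Body
  units n = replicate n (tag zero true)

  content-units : ∀ n → Represents (units n) (proj₂ (initial N (replicate n true)))
  content-units zero    zero    = refl
  content-units zero    (suc i) = sym (Vec.lookup-replicate i [])
  content-units (suc n) zero    = cong (true ∷_) (content-units n zero)
  content-units (suc n) (suc i) = content-units n (suc i)

  Input : ℤ → ℕ → Situation
  Input E n = rightward E (init zero) (map body (units n) ++ [ ⊢ ]) nothing []

  Input⊣ : ∀ E n → leftward E (turn zero) (map body (units n) ++ [ ⊢ ]) (just ⊣) [] ≡ Row E zero (units n)
  Input⊣ E n = cong (λ r → leftward E (turn zero) (map body r ++ [ ⊢ ]) (just ⊣) [])
    (sym (reverse-replicate _ n))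

  -- The guess `⊣` ends the input; every other letter adds a unit.
  afterInput : ℤ → ℕ → Letter → Situation
  afterInput E n ⊣        = leftward E (turn zero) (map body (units n) ++ [ ⊢ ]) (just ⊣) []
  afterInput E n ⊢        = Input (E ℤ.+ 1ℤ) (suc n)
  afterInput E n (body _) = Input (E ℤ.+ 1ℤ) (suc n)

  input-step : ∀ {E n a} → Readable a nothing → Input E n ↝⟨ a ⟩ afterInput E n a
  input-step {a = ⊢}      _ = grow-right refl refl
  input-step {a = ⊣}      _ = turn-right refl refl
  input-step {a = body _} _ = grow-right refl refl

  execute-halt : ∀ {q R b} → program q ≡ halt b → execute N (program q) R ≡ inj₁ b
  execute-halt {R = R} p = cong (λ c → execute N c R) p

  -- From a chain to a rejecting run.

  module Sound (P : Pattern 2 size) {e : Cell 2 size} (final : isFinal (decode (type e)) ≡ true) where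
    open Soundness goto≢start accepting-stuck P {e} final
    open Linear goto≢start accepting-stuck

    present⁺ : ∀ {C D n} → C ↝⁺ D → Present n C → ∃[ m ] (m < n × Present m D)
    present⁺ {D = D} TransClosure.[ p ] pr =
      let _ , m , _ , m<n , pr' = present-step {C' = λ _ → D} p pr in m , m<n , pr'
    present⁺ {n = n} (_∷_ {y = D} p w) pr =
      let _ , m , _ , m<n , pr'  = present-step {C' = λ _ → D} p pr
          k , k<m , pr'' = present⁺ w pr'
      in k , ℕ.<-trans k<m m<n , pr''

    Rejects : ℤ → Configuration N → Set
    Rejects E κ = HaltsWith N κ false × abscissa (vec e) ≡ column E 0

    -- Each round trip uses up part of the finite chain, so the run of the machine terminates.
    row-rejects : ∀ {n E} → Acc _<_ n → ∀ q {R} l → Represents l R → Present n (Row E q l) →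
      Rejects E (q , R)
    row-rejects {n} {E} (acc rs) q {R} l rep pr = aux (program q) refl
      where
      advance : ∀ {κ} c → program q ≡ c → execute N c R ≡ inj₂ κ → Rejects E (q , R)
      advance {κ} c p ex =
        let l' , rep' , run = machine-step {κ = κ} l rep c p ex
            m , m<n , pr'   = present⁺ (run E) pr
            h , x≡          = row-rejects (rs m<n) (proj₁ κ) l' rep' pr'
        in HaltsWith.next (trans (cong (λ c → execute N c R) p) ex) h , x≡

      stuck : ∀ b → program q ≡ halt b → rejecting (program q) ≡ true →
        abscissa (vec e) ≡ column E 0 → Rejects E (q , R)
      stuck false p _  x≡ = stop (execute-halt p) , x≡
      stuck true  p r≡ _  = contradiction (trans (sym r≡) (cong rejecting p)) λ ()

      aux : ∀ c → program q ≡ c → Rejects E (q , R)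
      aux c@(push _ _ _)  p = advance c p refl
      aux c@(pop _ _ _ _) p = advance c p refl
      aux (halt b)        p =
        let rej , x≡ = present-stuck {C = Row E q l} (λ _ → cong (nextTurn q) p) pr in stuck b p rej x≡

    -- `j` is the guessed length. The marker `⊢` in column `x` and `j` units put the right end at
    -- `x + suc j`.
    input-rejects : ∀ {n x} → Acc _<_ n → ∀ i {E} → E ≡ x ℤ.+ + suc i → Present n (Input E i) →
      ∃[ j ] Rejects (x ℤ.+ + suc j) (initial N (replicate j true))
    input-rejects {n} {x} (acc rs) i refl pr =
      let a , m , _ , m<n , pr' = present-step {C' = afterInput (x ℤ.+ + suc i) i} input-step pr
      in aux a m<n pr'
      where
      grow : ∀ {m} → m < n → Present m (Input ((x ℤ.+ + suc i) ℤ.+ 1ℤ) (suc i)) →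
        ∃[ j ] Rejects (x ℤ.+ + suc j) (initial N (replicate j true))
      grow m<n = input-rejects {x = x} (rs m<n) (suc i)
        (trans (ℤ.+-assoc x (+ suc i) 1ℤ) (cong (λ k → x ℤ.+ + k) (ℕ.+-comm (suc i) 1)))

      aux : ∀ a {m} → m < n → Present m (afterInput (x ℤ.+ + suc i) i a) →
        ∃[ j ] Rejects (x ℤ.+ + suc j) (initial N (replicate j true))
      aux ⊣        m<n pr' = i , row-rejects (rs m<n) zero (units i) (content-units i)
        (subst (Present _) (Input⊣ _ i) pr')
      aux ⊢        m<n pr' = grow m<n pr'
      aux (body _) m<n pr' = grow m<n pr'

    start-rejects : ∀ {n x y} →
      cellAt x y (start zero , origin , zero) ∈ cells P →
      Chain P e n (cellAt x y (start zero , origin , zero)) →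
      ∃[ j ] Rejects (x ℤ.+ + suc j) (initial N (replicate j true))
    start-rejects {n} {x} {y} c∈ γ =
      let _ , m , _ , _ , pr = present-step {C = rightward x (start zero) [] nothing []}
            {C' = λ _ → Input (x ℤ.+ 1ℤ) 0} (λ _ → grow-right refl refl) present₀
      in input-rejects {x = x} (<-wellFounded m) 0 refl pr
      where
      present₀ : Present n (rightward x (start zero) [] nothing [])
      -- The level of a situation is `H` below the base of the tile under the head.
      present₀ = y ℤ.- + H , origin , (tt , (λ ()) , tt) ,
        subst₂ (Entered n (start zero) origin) (sym (ℤ.+-identityʳ x)) (lemma y (+ H)) (entering c∈ γ)
        where
        lemma : ∀ y h → y ≡ (y ℤ.- h) ℤ.+ h
        lemma = solve-∀

  -- From a rejecting run to a pattern.

  readable-letter : ∀ c → ∃[ a ] Readable a c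
  readable-letter (just a) = a , known
  readable-letter nothing  = ⊢ , fresh

  built⁺ : ∀ {C D root γ} → C ↝⁺ D → Built root γ C → ∃[ γ' ] Built root γ' D
  built⁺ {C} TransClosure.[ p ] b = let a , r = readable-letter (under C) in built-step (p r) r b
  built⁺ {C} (p ∷ w)            b =
    let a , r  = readable-letter (under C)
        γ' , b' = built-step (p r) r b
    in built⁺ w b'

  Accepted : ℤ → Cell 2 size → Set
  Accepted E root = ∃[ γ ] ∃[ d ] (Rooted root γ × d ∈ γ × isFinal (decode (type d)) ≡ true ×
    abscissa (vec d) ≡ column E 0)

  row-accepted : ∀ {E root γ q R} → HaltsWith N (q , R) false → ∀ l → Represents l R →
    Built root γ (Row E q l) → Accepted E root
  row-accepted {E} {q = q} {R} (stop ex) l rep b =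
    built-accepting {C = Row E q l} {⊣} known (aux (program q) ex) b
    where
    aux : ∀ c → execute N c R ≡ inj₁ false → rejecting c ≡ true
    aux (halt false) refl = refl
  row-accepted {E} {q = q} {R} (HaltsWith.next {κ = κ} ex h) l rep b =
    let l' , rep' , run = machine-step {κ = κ} l rep (program q) refl ex
        γ' , b'         = built⁺ (run E) b
    in row-accepted h l' rep' b'

  root₀ : Cell 2 size
  root₀ = cellAt (column 0ℤ 0) (0ℤ ℤ.+ + H) (start zero , origin , zero)

  built-input : ∀ i → ∃[ γ ] Built root₀ γ (Input (+ suc i) i)
  built-input zero    = built-start 0ℤ 0ℤ refl refl
  built-input (suc i) =
    let γ , b = built-input i
        -- Any letter other than `⊣` prolongs the input.
        γ' , b' = built-step {a = ⊢} (input-step {+ suc i} {i} {⊢} fresh) fresh b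
    in γ' , subst (λ k → Built root₀ γ' (Input (+ k) (suc i))) (ℕ.+-comm (suc i) 1) b'

  input-accepted : ∀ n → HaltsWith N (initial N (replicate n true)) false →
    Accepted (+ suc n) root₀
  input-accepted n h =
    let γ , b = built-input n
        γ' , b' = built-step {a = ⊣} (input-step {+ suc n} {n} {⊣} fresh) fresh b
    in row-accepted h (units n) (content-units n) (subst (Built _ γ') (Input⊣ _ n) b')

  -- Overlap in terms of the verdict.

  code-start : code (start zero , origin , zero) ≡ zero
  code-start = code-decode zero

  HaltsWith-unique : ∀ {κ b b'} → HaltsWith N κ b → HaltsWith N κ b' → b ≡ b'
  HaltsWith-unique (stop p) (stop q) with refl ← trans (sym p) q = refl
  HaltsWith-unique (stop p) (HaltsWith.next q _) with () ← trans (sym p) q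
  HaltsWith-unique (HaltsWith.next p _) (stop q) with () ← trans (sym p) q
  HaltsWith-unique (HaltsWith.next p h) (HaltsWith.next q h') with refl ← trans (sym p) q = HaltsWith-unique h h'

  σ-overlapping : ∀ n → HaltsWith N (initial N (replicate n true)) false → Overlapping (σ (suc n))
  σ-overlapping n h =
    let γ , d , rooted , d∈ , f , x≡ = input-accepted n h
    in overlapping (suc n) {d = d} rooted code-start d∈ f (trans x≡ (ℤ.+-identityʳ (+ suc n)))

  -- The columns of its ends force a chain to have guessed exactly `n` units, so it would yield the
  -- opposite verdict on the same input.
  σ-nonOverlapping : ∀ n → HaltsWith N (initial N (replicate n true)) true → NonOverlapping (σ (suc n))
  σ-nonOverlapping n h = nonOverlapping (suc n) noChain
    where
    open Linear goto≢start accepting-stuck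
    noChain : ∀ P {c e k} → c ∈ cells P → type c ≡ zero → isFinal (decode (type e)) ≡ true →
      abscissa (vec e) ≡ abscissa (vec c) ℤ.+ + suc n → ¬ Chain P e k c
    noChain P {c} {e} {k} c∈ z f x≡ γ =
      let c≡ = located c z
          j , h' , x≡' = Sound.start-rejects P {e} f {k} {abscissa (vec c)} {y}
            (subst (_∈ cells P) c≡ c∈) (subst (Chain P e k) c≡ γ)
          j≡n = aux (abscissa (vec c)) (trans (sym x≡') x≡)
      in case HaltsWith-unique h (subst (λ j → HaltsWith N (initial N (replicate j true)) false) j≡n h') of λ ()
      where
      y : ℤ
      y = ordinate (vec c) ℤ.- + height (start zero) origin zero

      located : ∀ c → type c ≡ zero → c ≡ cellAt (abscissa (vec c))
        (ordinate (vec c) ℤ.- + height (start zero) origin zero) (start zero , origin , zero)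
      located c@record { vec = ⟪ a , b ⟫ } z = cell-≡ (⟪⟫-cong refl (lemma b _)) (trans z (sym code-start))
        where
        lemma : ∀ y h → y ≡ (y ℤ.- h) ℤ.+ h
        lemma = solve-∀

      aux : ∀ x {j} → column (x ℤ.+ + suc j) 0 ≡ x ℤ.+ + suc n → j ≡ n
      aux x {j} eq = ℕ.suc-injective (ℤ.+-injective (∙-cancelˡ x (+ suc j) (+ suc n)
        (trans (sym (ℤ.+-identityʳ (x ℤ.+ + suc j))) eq)))

  -- Either verdict of `N` makes the substitution behave contrary to it.
  diagonal : ∀ n {b} → Outputs N (replicate n true) b → ¬ Reflects (Overlapping (σ (suc n))) b
  diagonal n h (ofʸ overlaps) = overlaps (σ-nonOverlapping n h)
  diagonal n h (ofⁿ disjoint) = disjoint (σ-overlapping n h)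

-- Words as numerals in bijective base two, least significant digit first

inc : Word → Word
inc []          = false ∷ []
inc (false ∷ w) = true ∷ w
inc (true ∷ w)  = false ∷ inc w

incs : ℕ → Word → Word
incs zero    w = w
incs (suc n) w = incs n (inc w)

value : Word → ℕ
value []          = 0
value (false ∷ w) = suc (value w + value w)
value (true ∷ w)  = suc (suc (value w + value w))

-- Two increments restore the first digit and carry once.
incs-double : ∀ n b w → incs (n + n) (b ∷ w) ≡ b ∷ incs n w
incs-double zero    b     w = refl
incs-double (suc n) b     w rewrite ℕ.+-suc n n with b
... | false = incs-double n false (inc w)
... | true  = incs-double n true (inc w)

-- In bijective base two every word is a numeral, so counting from the empty word reaches it.
incs-value : ∀ w → incs (value w) [] ≡ w
incs-value []          = refl
incs-value (false ∷ w) = trans (incs-double (value w) false []) (cong (false ∷_) (incs-value w))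
incs-value (true ∷ w)  = trans (incs-double (value w) true []) (cong (true ∷_) (incs-value w))

-- The machine that reconstructs an encoding from its number.

module Frontend (M : Machine) where
  open Machine M

  pattern count    = 0F
  pattern tally    = 1F
  pattern carry    = 2F
  pattern carried  = 3F
  pattern lengthen = 4F
  pattern raise    = 5F
  pattern restore  = 6F
  pattern restored = 7F
  pattern emit     = 8F
  pattern emitted  = 9F
  pattern prefix₁  = suc 9F
  pattern prefix₂  = suc (suc 9F)
  pattern prefix₃  = suc (suc (suc 9F))
  pattern prefix₄  = suc (suc (suc (suc 9F)))

  liftInstruction : Instruction (suc states) (suc registers) →
    Instruction (14 + suc states) (3 + suc registers)
  liftInstruction (push i b q)  = push (3 ↑ʳ i) b (14 ↑ʳ q)
  liftInstruction (pop i p q r) = pop (3 ↑ʳ i) (14 ↑ʳ p) (14 ↑ʳ q) (14 ↑ʳ r)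
  liftInstruction (halt b)      = halt b

  -- Registers 0 to 2 are auxiliary; register 3 is the first one of M.  While
  -- counting register 0 down, a copy of it is kept in register 1, and register 3
  -- is incremented with its carries stored in register 2.

  code : Fin (14 + suc states) → Instruction (14 + suc states) (3 + suc registers)
  code count    = pop 0F emit tally tally
  code tally    = push 1F true carry
  code carry    = pop 3F lengthen raise carried
  code carried  = push 2F true carry
  code lengthen = push 3F false restore
  code raise    = push 3F true restore
  code restore  = pop 2F count restored restored
  code restored = push 3F false restore
  code emit     = pop 1F prefix₁ emitted emitted
  code emitted  = push 3F true emit
  code prefix₁  = push 3F true prefix₂
  code prefix₂  = push 3F false prefix₃
  code prefix₃  = push 3F true prefix₄
  code prefix₄  = push 3F true (14 ↑ʳ zero)
  code (suc (suc (suc (suc (suc (suc (suc (suc (suc (suc (suc (suc (suc (suc q)))))))))))))) =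
    liftInstruction (program q)

  N : Machine
  N = record { states = 13 + suc states ; registers = 3 + registers ; program = code }

  private variable
    b : Bool
    u u' v w : Word
    R : Vec.Vec Word registers

  liftConfiguration : Word → Word → Word → Configuration M → Configuration N
  liftConfiguration u u' v (q , R) = 14 ↑ʳ q , u ∷ u' ∷ v ∷ R

  execute-lift : ∀ c (R : Vec.Vec Word (suc registers)) →
    execute N (liftInstruction c) (u ∷ u' ∷ v ∷ R) ≡
    Sum.map id (liftConfiguration u u' v) (execute M c R)
  execute-lift (push i b q)  R = refl
  execute-lift (halt b)      R = refl
  execute-lift {u} {u'} {v} (pop i p q r) R = aux (Vec.lookup R i)
    where
    aux : ∀ w → inj₂ (popInto N (3 ↑ʳ i) (14 ↑ʳ p) (14 ↑ʳ q) (14 ↑ʳ r) w (u ∷ u' ∷ v ∷ R)) ≡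
      Sum.map {A = Bool} id (liftConfiguration u u' v) (inj₂ (popInto M i p q r w R))
    aux []          = refl
    aux (false ∷ _) = refl
    aux (true ∷ _)  = refl

  halts-lift : ∀ {κ} → HaltsWith M κ b → HaltsWith N (liftConfiguration u u' v κ) b
  halts-lift (stop {q = q} {R} ex) =
    stop (trans (execute-lift (program q) R) (cong (Sum.map id _) ex))
  halts-lift (next {q = q} {R} ex h) =
    next (trans (execute-lift (program q) R) (cong (Sum.map id _) ex)) (halts-lift h)

  pad : ℕ → Word → Word
  pad zero    w = w
  pad (suc c) w = pad c (false ∷ w)

  restore-run : ∀ c → HaltsWith N (count , u ∷ u' ∷ [] ∷ pad c w ∷ R) b →
    HaltsWith N (restore , u ∷ u' ∷ replicate c true ∷ w ∷ R) b
  restore-run zero    h = next refl h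
  restore-run (suc c) h = next refl (next refl (restore-run c h))

  -- The `c` digits `true` removed so far are recorded in register 2 and come back as digits
  -- `false`.
  carry-run : ∀ c w → HaltsWith N (count , u ∷ u' ∷ [] ∷ pad c (inc w) ∷ R) b →
    HaltsWith N (carry , u ∷ u' ∷ replicate c true ∷ w ∷ R) b
  carry-run c []          h = next refl (next refl (restore-run c h))
  carry-run c (false ∷ w) h = next refl (next refl (restore-run c h))
  carry-run c (true ∷ w)  h = next refl (next refl (carry-run (suc c) w h))

  -- Register 0 is moved to register 1, so `n + m` is invariant, and each letter moved causes one
  -- increment.
  count-run : ∀ n m w → HaltsWith N (emit , [] ∷ replicate (n + m) true ∷ [] ∷ incs n w ∷ R) b →
    HaltsWith N (count , replicate n true ∷ replicate m true ∷ [] ∷ w ∷ R) b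
  count-run zero    m w h = next refl h
  count-run {R} {b} (suc n) m w h = next refl (next refl (carry-run 0 w (count-run n (suc m) (inc w)
    (subst (λ k → HaltsWith N (emit , [] ∷ replicate k true ∷ [] ∷ incs n (inc w) ∷ R) b)
      (sym (ℕ.+-suc n m)) h))))

  emit-run : ∀ n w → HaltsWith N (prefix₁ , [] ∷ [] ∷ [] ∷ (replicate n true ++ w) ∷ R) b →
    HaltsWith N (emit , [] ∷ replicate n true ∷ [] ∷ w ∷ R) b
  emit-run zero    w h = next refl h
  emit-run {R} {b} (suc n) w h = next refl (next refl (emit-run n (true ∷ w)
    (subst (λ w → HaltsWith N (prefix₁ , [] ∷ [] ∷ [] ∷ w ∷ R) b) (sym (replicate-snoc true n w)) h)))

  outputs : ∀ {w r} → w ≡ true ∷ true ∷ false ∷ replicate (suc (value r)) true ++ r →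
    Outputs M w b → Outputs N (replicate (value r) true) b
  outputs {b} {r = r} refl h = count-run n 0 [] (subst
    (λ k → HaltsWith N (emit , [] ∷ replicate k true ∷ [] ∷ incs n [] ∷ Vec.replicate registers []) b)
    (sym (ℕ.+-identityʳ n))
    -- After the `n` letters emitted, `prefix₁` supplies the one that makes the block `suc n` long,
    -- and the other three states the constant first letters.
    (emit-run n (incs n []) (next refl (next refl (next refl (next refl (halts-lift
      (subst (λ w → Outputs M (true ∷ true ∷ false ∷ true ∷ replicate n true ++ w) b)
        (sym (incs-value r)) h))))))))
    where
    n : ℕ
    n = value r

-- Diagonalisation.

theorem3p3 : ¬ (Σ[ M ∈ Machine ] (∀ (n : ℕ) (σ : Substitution 2 n) → Consistent σ →
    Σ[ b ∈ Bool ] (Outputs M (encode σ) b × Reflects (Overlapping σ) b)))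
theorem3p3 (M , decides) = contradict (decides size (σ (suc n)) (σ-consistent (suc n)))
  where
  open Frontend M using (N; outputs)
  open Simulation N using (size; σ; σ-consistent; remainder; encode-σ; diagonal)

  -- `remainder` is computed from `σ 0` but is the same for every `σ X`, so choosing `X` as `suc n`
  -- is not circular.
  n : ℕ
  n = value remainder

  contradict : ¬ (Σ[ b ∈ Bool ] (Outputs M (encode (σ (suc n))) b × Reflects (Overlapping (σ (suc n))) b))
  contradict (b , h , r) =
    diagonal n (outputs {w = encode (σ (suc n))} {remainder} (encode-σ (suc n)) h) r
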